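{- The integrality gap of the semidefinite program $\mathrm{SDP}_2$ (the symmetry-reduced QAP relaxation of the traveling salesman problem defined in the context) is unbounded; that is, $$\sup_{D\in\mathcal{D}} \frac{\mathrm{OPT}_{\mathrm{TSP}}(D)}{\mathrm{OPT}_{\mathrm{SDP}_2}(D)}=+\infty .$$
   Context: TSP: an instance on $N$ vertices is a symmetric matrix $D=(d_{ij})\in\mathbb{R}^{N\times N}$ with $d_{ij}\ge 0$, $d_{ii}=0$ and $d_{ij}\le d_{ik}+d_{kj}$ for all $i,j,k$ (distinct vertices may be at distance $0$). $\mathcal{D}$ is the set of all such matrices, over all $N\ge 3$. $\mathrm{OPT}_{\mathrm{TSP}}(D)$ is the minimum total cost of a Hamiltonian cycle in the complete graph $K_N$ with edge costs $d_{ij}$. Notation: $[m]=\{1,\dots,m\}$; $I_m$, $J_m$ are the $m\times m$ identity and all-ones matrices; $E^{(m)}_{jj}$ is the $m\times m$ matrix with a single $1$ in position $(j,j)$; $\mathbb{S}^{m\times m}$ is the set of real symmetric $m\times m$ matrices; $M[S,T]$ is the submatrix of $M$ with rows in $S$ and columns in $T$, and $M[S]=M[S,S]$; $\mathrm{Diag}(x)$ is the diagonal matrix with diagonal $x$; $\mathrm{vec}(M)$ stacks the columns of $M$; $\otimes$ is the Kronecker product; $Y\ge 0$ is entrywise nonnegativity and $Y\succeq 0$ is positive semidefiniteness. $C^{(N)}_1$ is the adjacency matrix of the $N$-cycle on $[N]$ with edges $\{i,i+1\}$ and $\{N,1\}$. $\mathrm{SDP}_2$: for an $N$-vertex instance $D$,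 put $n=N-1$, fix $r,s\in[n+1]$, and let $\alpha=[n+1]\setminus\{r\}$, $\beta=[n+1]\setminus\{s\}$, $\bar c=\mathrm{vec}\big(C^{(n+1)}_1[\alpha,\{r\}]\,D[\{s\},\beta]\big)\in\mathbb{R}^{n^2}$. Then $\mathrm{OPT}_{\mathrm{SDP}_2}(D)$ is the minimum of $$\mathrm{trace}\Big(\big(D[\beta]\otimes \tfrac12 C^{(n+1)}_1[\alpha]+\mathrm{Diag}(\bar c)\big)Y\Big)$$ over $Y\in\mathbb{S}^{n^2\times n^2}$ with $Y\ge 0$, $Y\succeq 0$ and (i) $\mathrm{trace}((I_n\otimes E^{(n)}_{jj})Y)=1$ for $j=1,\dots,n$; (ii) $\mathrm{trace}((E^{(n)}_{jj}\otimes I_n)Y)=1$ for $j=1,\dots,n$; (iii) $\mathrm{trace}\big((I_n\otimes(J_n-I_n)+(J_n-I_n)\otimes I_n)Y\big)=0$; (iv) $\mathrm{trace}((J_n\otimes J_n)Y)=n^2$. The choice of $r,s$ for each $N$ is arbitrary but fixed (one may take $r=s=1$). In the supremum, instances with $\mathrm{OPT}_{\mathrm{TSP}}(D)=0$ are disregarded, and a ratio with positive numerator and zero denominator is read as $+\infty$. -}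

module Defs where

open import Level using (Level; 0ℓ; _⊔_)
open import Algebra.Bundles using (CommutativeRing)
import Algebra.Properties.Semiring.Mult as SemiringMult
import Algebra.Properties.Semiring.Sum as SemiringSum
open import Data.Bool.Base using (if_then_else_)
open import Data.Fin.Base using (Fin; toℕ; punchIn; remQuot)
open import Data.Fin.Permutation using (Permutation′; _⟨$⟩ʳ_)
open import Data.Fin.Properties using () renaming (_≟_ to _≟ᶠ_)
open import Data.Nat.Base as ℕ using (ℕ; suc)
open import Data.Nat.DivMod using (_mod_)
open import Data.Product.Base using (∃; _×_; _,_)
open import Data.Vec.Functional using (Vector)
open import Relation.Binary.Core using (Rel)
open import Relation.Binary.Structures using (IsTotalOrder)
import Relation.Binary.Construct.Add.Supremum.NonStrict as AddSupremum
import Relation.Binary.Construct.NonStrictToStrict as ToStrict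
open import Relation.Nullary using (¬_; does; _⊎-dec_)
open import Relation.Nullary.Construct.Add.Supremum using (_⁺; [_]; ⊤⁺)

module _ {a ℓ p : Level} {A : Set a} (_≤_ : Rel A ℓ) where

  UpperBound : (A → Set p) → A → Set (a ⊔ ℓ ⊔ p)
  UpperBound P u = ∀ {x} → P x → x ≤ u

  record IsSupremum (P : A → Set p) (s : A) : Set (a ⊔ ℓ ⊔ p) where
    field
      upper : UpperBound P s
      least : ∀ {u} → UpperBound P u → s ≤ u

  record IsMinimum (P : A → Set p) (m : A) : Set (a ⊔ ℓ ⊔ p) where
    field
      attained   : P m
      lowerBound : ∀ {x} → P x → m ≤ x

-- The library has no type of real numbers, so ℝ is characterised as a
-- Dedekind-complete ordered field (unique up to isomorphism), with a setoid
-- equality.  The inverse is total; nothing is assumed of its value at 0#.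
record CompleteOrderedField : Set₁ where
  infix  4 _≤_ _≤⁺_
  infix  8 _⁻¹
  field
    commutativeRing : CommutativeRing 0ℓ 0ℓ

  open CommutativeRing commutativeRing public

  field
    _⁻¹          : Carrier → Carrier
    _≤_          : Rel Carrier 0ℓ
    0≉1          : ¬ (0# ≈ 1#)
    ⁻¹-inverseʳ  : ∀ x → ¬ (x ≈ 0#) → x * x ⁻¹ ≈ 1#
    isTotalOrder : IsTotalOrder _≈_ _≤_
    +-monoˡ-≤    : ∀ {x y} z → x ≤ y → x + z ≤ y + z
    *-nonNeg     : ∀ {x y} → 0# ≤ x → 0# ≤ y → 0# ≤ x * y
    complete     : (P : Carrier → Set) → ∃ P → ∃ (UpperBound _≤_ P) →
                   ∃ (IsSupremum _≤_ P)

  open ToStrict _≈_ _≤_ public using (_<_)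

  infixl 7 _/_
  _/_ : Carrier → Carrier → Carrier
  x / y = x * y ⁻¹

  ½ : Carrier
  ½ = 1# / (1# + 1#)

  -- Carrier ⁺ adjoins +∞ (written ⊤⁺); all ratios considered lie in [0,+∞].
  _≤⁺_ : Rel (Carrier ⁺) 0ℓ
  _≤⁺_ = AddSupremum._≤⁺_ _≤_

next : ∀ {n} → Fin (suc n) → Fin (suc n)
next {n} i = suc (toℕ i) mod suc n

module SDP₂ (ℝ : CompleteOrderedField) where

  open CompleteOrderedField ℝ
  open SemiringSum semiring using (sum)
  open SemiringMult semiring using () renaming (_×_ to _×ₙ_)

  Matrix : ℕ → ℕ → Set
  Matrix m n = Fin m → Fin n → Carrier

  infixl 6 _⊕_ _⊖_
  infixl 7 _⊗_ _·_ _*ₛ_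

  _⊕_ : ∀ {m n} → Matrix m n → Matrix m n → Matrix m n
  (A ⊕ B) i j = A i j + B i j

  _⊖_ : ∀ {m n} → Matrix m n → Matrix m n → Matrix m n
  (A ⊖ B) i j = A i j - B i j

  _*ₛ_ : ∀ {m n} → Carrier → Matrix m n → Matrix m n
  (c *ₛ A) i j = c * A i j

  _·_ : ∀ {m n p} → Matrix m n → Matrix n p → Matrix m p
  (A · B) i k = sum (λ j → A i j * B j k)

  trace : ∀ {n} → Matrix n n → Carrier
  trace A = sum (λ i → A i i)

  -- remQuot splits an index of Fin (m * p) as (block, position in block),
  -- i.e. k = toℕ block * p + toℕ position.
  _⊗_ : ∀ {m n p q} → Matrix m n → Matrix p q → Matrix (m ℕ.* p) (n ℕ.* q)
  _⊗_ {p = p} {q = q} A B k l with remQuot p k | remQuot q l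
  ... | i₁ , i₂ | j₁ , j₂ = A i₁ j₁ * B i₂ j₂

  -- Column stacking: the block is the column index.
  vec : ∀ {m n} → Matrix m n → Vector Carrier (n ℕ.* m)
  vec {m = m} A k with remQuot m k
  ... | col , row = A row col

  I : ∀ {n} → Matrix n n
  I i j = if does (i ≟ᶠ j) then 1# else 0#

  J : ∀ {n} → Matrix n n
  J i j = 1#

  -- E k is the matrix unit with its 1 in position (k , k).
  E : ∀ {n} → Fin n → Matrix n n
  E k i j = I i k * I k j

  Diag : ∀ {n} → Vector Carrier n → Matrix n n
  Diag x i j = if does (i ≟ᶠ j) then x i else 0#

  -- The index sets S and T are given by their increasing enumerations.
  submatrix : ∀ {m n p q} → Matrix m n → (Fin p → Fin m) → (Fin q → Fin n) → Matrix p q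
  submatrix A S T i j = A (S i) (T j)

  Symmetric : ∀ {n} → Matrix n n → Set
  Symmetric A = ∀ i j → A i j ≈ A j i

  Nonnegative : ∀ {m n} → Matrix m n → Set
  Nonnegative A = ∀ i j → 0# ≤ A i j

  PositiveSemidefinite : ∀ {n} → Matrix n n → Set
  PositiveSemidefinite {n} A =
    Symmetric A × (∀ (x : Vector Carrier n) → 0# ≤ sum (λ i → sum (λ j → x i * A i j * x j)))

  cycleAdjacency : ∀ {n} → Matrix (suc n) (suc n)
  cycleAdjacency i j = if does ((j ≟ᶠ next i) ⊎-dec (i ≟ᶠ next j)) then 1# else 0#

  record IsTSPInstance {N : ℕ} (D : Matrix N N) : Set where
    field
      symmetric   : Symmetric D
      nonnegative : Nonnegative D
      zeroDiag    : ∀ i → D i i ≈ 0#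
      triangle    : ∀ i j k → D i j ≤ D i k + D k j

  -- A Hamiltonian cycle of the complete graph is given by the order
  -- σ 0, σ 1, …, σ n in which it visits the vertices before returning to σ 0.
  tourCost : ∀ {n} → Matrix (suc n) (suc n) → Permutation′ (suc n) → Carrier
  tourCost D σ = sum (λ i → D (σ ⟨$⟩ʳ i) (σ ⟨$⟩ʳ next i))

  IsTourCost : ∀ {n} → Matrix (suc n) (suc n) → Carrier → Set
  IsTourCost D x = ∃ λ σ → x ≈ tourCost D σ

  IsOPT-TSP : ∀ {n} → Matrix (suc n) (suc n) → Carrier → Set
  IsOPT-TSP D = IsMinimum _≤_ (IsTourCost D)

  record Feasible {n : ℕ} (Y : Matrix (n ℕ.* n) (n ℕ.* n)) : Set where
    field
      nonnegative          : Nonnegative Y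
      positiveSemidefinite : PositiveSemidefinite Y
      inner                : ∀ (j : Fin n) → trace ((I {n} ⊗ E j) · Y) ≈ 1#
      outer                : ∀ (j : Fin n) → trace ((E j ⊗ I {n}) · Y) ≈ 1#
      gangster             : trace ((I {n} ⊗ (J {n} ⊖ I) ⊕ (J {n} ⊖ I) ⊗ I {n}) · Y) ≈ 0#
      total                : trace ((J {n} ⊗ J {n}) · Y) ≈ (n ℕ.* n) ×ₙ 1#

  module _ {n : ℕ} (r s : Fin (suc n)) (D : Matrix (suc n) (suc n)) where

    private
      α β : Fin n → Fin (suc n)
      α = punchIn r
      β = punchIn s

      ⟨r⟩ ⟨s⟩ : Fin 1 → Fin (suc n)
      ⟨r⟩ _ = r
      ⟨s⟩ _ = s

    c̄ : Vector Carrier (n ℕ.* n)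
    c̄ = vec (submatrix cycleAdjacency α ⟨r⟩ · submatrix D ⟨s⟩ β)

    objective : Matrix (n ℕ.* n) (n ℕ.* n) → Carrier
    objective Y =
      trace ((submatrix D β β ⊗ (½ *ₛ submatrix cycleAdjacency α α) ⊕ Diag c̄) · Y)

    IsSDP₂Value : Carrier → Set
    IsSDP₂Value x = ∃ λ Y → Feasible {n} Y × x ≈ objective Y

    IsOPT-SDP₂ : Carrier → Set
    IsOPT-SDP₂ = IsMinimum _≤_ IsSDP₂Value

  data Ratio (t v : Carrier) : Carrier ⁺ → Set where
    finite   : ¬ (v ≈ 0#) → Ratio t v [ t / v ]
    infinite : 0# < t → v ≈ 0# → Ratio t v ⊤⁺

  -- The set of ratios OPT-TSP(D) / OPT-SDP₂(D) over all instances on suc n ≥ 3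
  -- vertices with OPT-TSP(D) ≠ 0; r n and s n are the vertices chosen for suc n.
  record IsGapRatio (r s : ∀ n → Fin (suc n)) (q : Carrier ⁺) : Set where
    field
      n         : ℕ
      3≤N       : 3 ℕ.≤ suc n
      D         : Matrix (suc n) (suc n)
      instanceD : IsTSPInstance D
      tsp sdp   : Carrier
      isTSP     : IsOPT-TSP D tsp
      isSDP₂    : IsOPT-SDP₂ (r n) (s n) D sdp
      tsp≉0     : ¬ (tsp ≈ 0#)
      isRatio   : Ratio tsp sdp q

{-# OPTIONS --safe #-}
module Submission where

-- Split n = k b vertices into k = m groups of size b = 2m, add the vertex s, and let
-- D be the cut metric separating one group from everything else.  Every tour crosses
-- the cut, so it costs at least 1.  A feasible Y only has to look like a random
-- assignment of vertices to positions at the level of pairs, so the event "positions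
-- i and j carry vertices of the same group" may be given any "probability" κ i j for
-- which κ is a matrix with entries in [0,1], unit diagonal and row sums b, with kκ - J
-- positive semidefinite.  The resulting objective is at most
-- (2/k) (n max (1 - κ i (i+1)) + 1).  An actual partition into intervals has
-- 1 - κ i (i+1) of order 1/b, but the normalised cyclic autocorrelation of a tent of
-- height m has 1 - κ i (i+1) = O(1/m²), so that the objective is at most 10/m.  The
-- minimum is attained by compactness, hence the ratio is at least m/10.

open import Level using (0ℓ)
open import Algebra.Bundles using (CommutativeRing; RawRing)
import Algebra.Properties.Semiring.Mult as SemiringMult
import Algebra.Properties.Semiring.Sum as SemiringSum
open import Axiom.ExcludedMiddle using (ExcludedMiddle)
open import Data.Bool.Base using (Bool; true; false; not; if_then_else_; _xor_)
open import Data.Bool.Properties using (xor-same; xor-comm) renaming (_≟_ to _≟ᵇ_)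
open import Data.Empty using (⊥-elim)
open import Data.Fin.Base using (Fin; zero; suc; toℕ; punchIn; remQuot; combine; inject₁; _↑ˡ_; _↑ʳ_)
open import Data.Fin.Permutation as Perm using (_⟨$⟩ʳ_; _⟨$⟩ˡ_)
open import Data.Fin.Properties as Fin using () renaming (_≟_ to _≟ᶠ_)
open import Data.Integer.Base as ℤ using (ℤ; +_; -[1+_])
import Data.Integer.Properties as ℤ
open import Data.Maybe.Base using (Maybe; just; nothing)
open import Data.Nat.Base as ℕ using (ℕ; zero; suc; z≤n; s≤s; NonZero)
open import Data.Nat.DivMod as ℕ using (_%_; _mod_)
import Data.Nat.Properties as ℕ
open import Data.Product.Base using (∃; _×_; _,_; proj₁; proj₂; uncurry)
import Data.Sign.Base as Sign
open import Data.Sum.Base using (_⊎_; inj₁; inj₂)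
open import Data.Vec.Functional using (Vector; _∷_; insertAt)
open import Data.Vec.Functional.Properties using (insertAt-lookup; insertAt-punchIn)
open import Function.Base using (_∘_; _$_)
open import Relation.Binary.Bundles using (Poset)
import Relation.Binary.Construct.Add.Supremum.NonStrict as AddSupremum
open import Relation.Binary.PropositionalEquality as ≡ using (_≡_)
open import Relation.Binary.Structures using (IsTotalOrder)
open import Relation.Nullary using (¬_; Dec; yes; no; does)
open import Relation.Nullary.Construct.Add.Supremum using ([_]; ⊤⁺)
open import Relation.Nullary.Decidable using (dec-true)
open import Defs

-- The scaling fixes the parameters. If `1 - κ` is `δ` between neighbours, the bound on the
-- objective is of order `(k b δ + 1) / k`, so `k b δ` must stay bounded while `k` grows. With `δ`
-- of order `1/b` the objective stays of constant order; with `δ` of order `1/b²` the number `k` of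
-- groups may grow like `b`, hence `k = m` and `b = 2m`. The gain comes from Gram matrices: `1 - κ`
-- is proportional to the squared distance between a function and its shift. One step moves the
-- indicator of an interval at two points, whatever its length, while a tent of height `m` changes
-- by a relative `1/m` at each of its points, so that the relative squared distance is quadratic in
-- `1/m`. The autocorrelation alone has the wrong row sums. A multiple of `J` corrects them, and its
-- coefficient is nonnegative because the tent is supported on about `b` points (Cauchy-Schwarz on
-- the support). `κ` is cyclic because the deleted position `r` is arbitrary: the path that remains
-- may wrap around.

-- A ring solver with integer coefficients.

module IntegerSolver {c ℓ} (R : CommutativeRing c ℓ) where

  open CommutativeRing R
  open import Algebra.Properties.Ring ring
  open import Algebra.Properties.AbelianGroup +-abelianGroup using (⁻¹-∙-comm)
  open import Algebra.Properties.Semiring.Mult.TCOptimised semiring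
    using (×1-homo-*) renaming (_×_ to _×′_; ×-homo-+ to ×′-homo-+; 1+× to 1+×′)
  open import Algebra.Properties.CommutativeSemigroup +-commutativeSemigroup using (interchange)
  open import Relation.Binary.Reasoning.Setoid setoid
  open import Algebra.Solver.Ring.AlmostCommutativeRing

  -- Integer coefficients can be compared by computation, which real ones cannot. The optimised
  -- multiple makes `fromℤ (+ 1)` reduce to `1#`, so `con (+ 1)` stands for `1#` definitionally in
  -- every later call.
  fromℤ : ℤ → Carrier
  fromℤ (+ n)    = n ×′ 1#
  fromℤ -[1+ n ] = - (suc n ×′ 1#)

  fromℤ-⊖ : ∀ m n → fromℤ (m ℤ.⊖ n) ≈ m ×′ 1# + - (n ×′ 1#)
  fromℤ-⊖ zero    zero    = sym (-‿inverseʳ 0#)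
  fromℤ-⊖ zero    (suc n) = sym (+-identityˡ _)
  fromℤ-⊖ (suc m) zero    = sym (trans (+-congˡ -0#≈0#) (+-identityʳ _))
  fromℤ-⊖ (suc m) (suc n) = begin
    fromℤ (suc m ℤ.⊖ suc n)                      ≡⟨ ≡.cong fromℤ (ℤ.[1+m]⊖[1+n]≡m⊖n m n) ⟩
    fromℤ (m ℤ.⊖ n)                              ≈⟨ fromℤ-⊖ m n ⟩
    m ×′ 1# + - (n ×′ 1#)                        ≈⟨ +-identityˡ _ ⟨
    0# + (m ×′ 1# + - (n ×′ 1#))                 ≈⟨ +-congʳ (-‿inverseʳ 1#) ⟨
    1# + - 1# + (m ×′ 1# + - (n ×′ 1#))          ≈⟨ interchange _ _ _ _ ⟩
    1# + m ×′ 1# + (- 1# + - (n ×′ 1#))          ≈⟨ +-congˡ (⁻¹-∙-comm _ _) ⟩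
    1# + m ×′ 1# + - (1# + n ×′ 1#)              ≈⟨ +-cong (1+×′ m 1#) (-‿cong (1+×′ n 1#)) ⟨
    suc m ×′ 1# + - (suc n ×′ 1#)                ∎

  fromℤ-+ : ∀ i j → fromℤ (i ℤ.+ j) ≈ fromℤ i + fromℤ j
  fromℤ-+ (+ m)    (+ n)    = ×′-homo-+ 1# m n
  fromℤ-+ (+ m)    -[1+ n ] = fromℤ-⊖ m (suc n)
  fromℤ-+ -[1+ m ] (+ n)    = trans (fromℤ-⊖ n (suc m)) (+-comm _ _)
  fromℤ-+ -[1+ m ] -[1+ n ] = begin
    - (suc (suc (m ℕ.+ n)) ×′ 1#)          ≡⟨ ≡.cong (λ k → - (suc k ×′ 1#)) (≡.sym (ℕ.+-suc m n)) ⟩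
    - ((suc m ℕ.+ suc n) ×′ 1#)            ≈⟨ -‿cong (×′-homo-+ 1# (suc m) (suc n)) ⟩
    - (suc m ×′ 1# + suc n ×′ 1#)          ≈⟨ ⁻¹-∙-comm _ _ ⟨
    - (suc m ×′ 1#) + - (suc n ×′ 1#)      ∎

  fromℤ-neg : ∀ i → fromℤ (ℤ.- i) ≈ - fromℤ i
  fromℤ-neg (+ zero)  = sym -0#≈0#
  fromℤ-neg (+ suc n) = refl
  fromℤ-neg -[1+ n ]  = sym (-‿involutive _)

  fromℤ-◃ : ∀ n → fromℤ (Sign.- ℤ.◃ n) ≈ - (n ×′ 1#)
  fromℤ-◃ zero    = sym -0#≈0#
  fromℤ-◃ (suc n) = refl

  fromℤ-* : ∀ i j → fromℤ (i ℤ.* j) ≈ fromℤ i * fromℤ j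
  fromℤ-* (+ m)    (+ n)    = begin
    fromℤ (Sign.+ ℤ.◃ m ℕ.* n)  ≡⟨ ≡.cong fromℤ (ℤ.+◃n≡+n (m ℕ.* n)) ⟩
    (m ℕ.* n) ×′ 1#             ≈⟨ ×1-homo-* m n ⟩
    m ×′ 1# * n ×′ 1#           ∎
  fromℤ-* (+ m)    -[1+ n ] = begin
    fromℤ (Sign.- ℤ.◃ m ℕ.* suc n)  ≈⟨ fromℤ-◃ (m ℕ.* suc n) ⟩
    - ((m ℕ.* suc n) ×′ 1#)         ≈⟨ -‿cong (×1-homo-* m (suc n)) ⟩
    - (m ×′ 1# * suc n ×′ 1#)       ≈⟨ -‿distribʳ-* _ _ ⟩
    m ×′ 1# * - (suc n ×′ 1#)       ∎
  fromℤ-* -[1+ m ] (+ n)    = begin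
    fromℤ (Sign.- ℤ.◃ suc m ℕ.* n)  ≈⟨ fromℤ-◃ (suc m ℕ.* n) ⟩
    - ((suc m ℕ.* n) ×′ 1#)         ≈⟨ -‿cong (×1-homo-* (suc m) n) ⟩
    - (suc m ×′ 1# * n ×′ 1#)       ≈⟨ -‿distribˡ-* _ _ ⟩
    - (suc m ×′ 1#) * n ×′ 1#       ∎
  fromℤ-* -[1+ m ] -[1+ n ] = begin
    (suc m ℕ.* suc n) ×′ 1#               ≈⟨ ×1-homo-* (suc m) (suc n) ⟩
    suc m ×′ 1# * suc n ×′ 1#             ≈⟨ -‿involutive _ ⟨
    - - (suc m ×′ 1# * suc n ×′ 1#)       ≈⟨ -‿cong (-‿distribˡ-* _ _) ⟩
    - (- (suc m ×′ 1#) * suc n ×′ 1#)     ≈⟨ -‿distribʳ-* _ _ ⟩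
    - (suc m ×′ 1#) * - (suc n ×′ 1#)     ∎

  private
    ℤ-rawRing : RawRing _ _
    ℤ-rawRing = ℤ.+-*-rawRing

    homomorphism : ℤ-rawRing -Raw-AlmostCommutative⟶ fromCommutativeRing R
    homomorphism = record
      { ⟦_⟧ = fromℤ ; +-homo = fromℤ-+ ; *-homo = fromℤ-* ; -‿homo = fromℤ-neg
      ; 0-homo = refl ; 1-homo = refl }

    fromℤ-≟ : ∀ i j → Maybe (fromℤ i ≈ fromℤ j)
    fromℤ-≟ i j with i ℤ.≟ j
    ... | yes i≡j = just (reflexive (≡.cong fromℤ i≡j))
    ... | no  _   = nothing

  open import Algebra.Solver.Ring ℤ-rawRing (fromCommutativeRing R) homomorphism fromℤ-≟ public

-- Ordered field arithmetic and the Archimedean property.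

module OrderedField (ℝ : CompleteOrderedField) where
  open CompleteOrderedField ℝ hiding (zero)
  open IntegerSolver commutativeRing public hiding (_*N_; _+N_; _^N_)
  open SemiringMult semiring using (×1-homo-*) renaming (_×_ to _×ₙ_; ×-homo-+ to ×ₙ-homo-+)
  open IsTotalOrder isTotalOrder public
    using (total; antisym; ≤-respˡ-≈; ≤-respʳ-≈)
    renaming (refl to ≤-refl; trans to ≤-trans; reflexive to ≤-reflexive)

  ≤-poset : Poset 0ℓ 0ℓ 0ℓ
  ≤-poset = record { isPartialOrder = IsTotalOrder.isPartialOrder isTotalOrder }

  module ≤-Reasoning where
    open import Relation.Binary.Reasoning.PartialOrder ≤-poset public

  private
    𝟘 𝟙 : ∀ {n} → Polynomial n
    𝟘 = con (+ 0)
    𝟙 = con (+ 1)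

  -- Reduces an inequality to a ring identity with a nonnegative remainder `d`; many estimates pair
  -- it with the solver.
  ≤-by : ∀ {x y d} → 0# ≤ d → y ≈ x + d → x ≤ y
  ≤-by {x} {y} {d} 0≤d y≈x+d = begin
    x       ≈⟨ +-identityˡ x ⟨
    0# + x  ≤⟨ +-monoˡ-≤ x 0≤d ⟩
    d + x   ≈⟨ +-comm d x ⟩
    x + d   ≈⟨ y≈x+d ⟨
    y       ∎
    where open ≤-Reasoning

  0≤y-x : ∀ {x y} → x ≤ y → 0# ≤ y - x
  0≤y-x {x} {y} x≤y = ≤-respˡ-≈ (-‿inverseʳ x) (+-monoˡ-≤ (- x) x≤y)

  x≤y : ∀ {x y} → 0# ≤ y - x → x ≤ y
  x≤y {x} {y} p = ≤-by p (solve 2 (λ x y → y := x :+ (y :- x)) refl x y)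

  +-mono-≤ : ∀ {x y u v} → x ≤ y → u ≤ v → x + u ≤ y + v
  +-mono-≤ {x} {y} {u} {v} x≤y u≤v = begin
    x + u  ≤⟨ +-monoˡ-≤ u x≤y ⟩
    y + u  ≈⟨ +-comm y u ⟩
    u + y  ≤⟨ +-monoˡ-≤ y u≤v ⟩
    v + y  ≈⟨ +-comm v y ⟩
    y + v  ∎
    where open ≤-Reasoning

  +-nonNeg : ∀ {x y} → 0# ≤ x → 0# ≤ y → 0# ≤ x + y
  +-nonNeg 0≤x 0≤y = ≤-respˡ-≈ (+-identityˡ 0#) (+-mono-≤ 0≤x 0≤y)

  *-monoʳ-≤ : ∀ {z x y} → 0# ≤ z → x ≤ y → z * x ≤ z * y
  *-monoʳ-≤ {z} {x} {y} 0≤z x≤y = ≤-by (*-nonNeg 0≤z (0≤y-x x≤y))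
    (solve 3 (λ x y z → z :* y := z :* x :+ z :* (y :- x)) refl x y z)

  *-monoˡ-≤ : ∀ {z x y} → 0# ≤ z → x ≤ y → x * z ≤ y * z
  *-monoˡ-≤ {z} {x} {y} 0≤z x≤y = ≤-by (*-nonNeg 0≤z (0≤y-x x≤y))
    (solve 3 (λ x y z → y :* z := x :* z :+ z :* (y :- x)) refl x y z)

  *-mono-≤ : ∀ {x y u v} → 0# ≤ y → 0# ≤ u → x ≤ y → u ≤ v → x * u ≤ y * v
  *-mono-≤ 0≤y 0≤u x≤y u≤v = ≤-trans (*-monoˡ-≤ 0≤u x≤y) (*-monoʳ-≤ 0≤y u≤v)

  neg-nonNeg : ∀ {x} → x ≤ 0# → 0# ≤ - x
  neg-nonNeg {x} x≤0 = ≤-respʳ-≈ (+-identityˡ (- x)) (0≤y-x x≤0)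

  square-nonNeg : ∀ x → 0# ≤ x * x
  square-nonNeg x with total 0# x
  ... | inj₁ 0≤x = *-nonNeg 0≤x 0≤x
  ... | inj₂ x≤0 = ≤-respʳ-≈ (solve 1 (λ x → (:- x) :* (:- x) := x :* x) refl x)
                     (*-nonNeg (neg-nonNeg x≤0) (neg-nonNeg x≤0))

  0≤1 : 0# ≤ 1#
  0≤1 = ≤-respʳ-≈ (*-identityˡ 1#) (square-nonNeg 1#)

  1≰0 : ¬ (1# ≤ 0#)
  1≰0 1≤0 = 0≉1 (antisym 0≤1 1≤0)

  ⁻¹-nonNeg : ∀ {x} → 0# ≤ x → ¬ (x ≈ 0#) → 0# ≤ x ⁻¹
  ⁻¹-nonNeg {x} 0≤x x≉0 with total 0# (x ⁻¹)
  ... | inj₁ 0≤x⁻¹ = 0≤x⁻¹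
  ... | inj₂ x⁻¹≤0 = ⊥-elim $ 1≰0 $ begin
    1#        ≈⟨ ⁻¹-inverseʳ x x≉0 ⟨
    x * x ⁻¹  ≤⟨ *-monoʳ-≤ 0≤x x⁻¹≤0 ⟩
    x * 0#    ≈⟨ zeroʳ x ⟩
    0#        ∎
    where open ≤-Reasoning

  1≤* : ∀ {x y} → 1# ≤ x → 1# ≤ y → 1# ≤ x * y
  1≤* 1≤x 1≤y = ≤-respˡ-≈ (*-identityˡ 1#) (*-mono-≤ (≤-trans 0≤1 1≤x) 0≤1 1≤x 1≤y)

  1≤⇒≉0 : ∀ {x} → 1# ≤ x → ¬ (x ≈ 0#)
  1≤⇒≉0 1≤x x≈0 = 1≰0 (≤-respʳ-≈ x≈0 1≤x)

  *-cancelˡ-≤ : ∀ {z x y} → 0# ≤ z → ¬ (z ≈ 0#) → z * x ≤ z * y → x ≤ y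
  *-cancelˡ-≤ {z} {x} {y} 0≤z z≉0 zx≤zy = begin
    x               ≈⟨ cancel x ⟩
    z ⁻¹ * (z * x)  ≤⟨ *-monoʳ-≤ (⁻¹-nonNeg 0≤z z≉0) zx≤zy ⟩
    z ⁻¹ * (z * y)  ≈⟨ cancel y ⟨
    y               ∎
    where
    open ≤-Reasoning
    cancel : ∀ x → x ≈ z ⁻¹ * (z * x)
    cancel x = begin-equality
      x               ≈⟨ *-identityˡ x ⟨
      1# * x          ≈⟨ *-congʳ (⁻¹-inverseʳ z z≉0) ⟨
      z * z ⁻¹ * x    ≈⟨ solve 3 (λ z w x → z :* w :* x := w :* (z :* x)) refl z (z ⁻¹) x ⟩
      z ⁻¹ * (z * x)  ∎

  *-cancelˡ-nonNeg : ∀ {z x} → 0# ≤ z → ¬ (z ≈ 0#) → 0# ≤ z * x → 0# ≤ x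
  *-cancelˡ-nonNeg {z} 0≤z z≉0 p = *-cancelˡ-≤ 0≤z z≉0 (≤-respˡ-≈ (sym (zeroʳ z)) p)

  fromℕ : ℕ → Carrier
  fromℕ n = n ×ₙ 1#

  fromℕ-+ : ∀ m n → fromℕ (m ℕ.+ n) ≈ fromℕ m + fromℕ n
  fromℕ-+ = ×ₙ-homo-+ 1#

  fromℕ-* : ∀ m n → fromℕ (m ℕ.* n) ≈ fromℕ m * fromℕ n
  fromℕ-* = ×1-homo-*

  fromℕ-nonNeg : ∀ n → 0# ≤ fromℕ n
  fromℕ-nonNeg zero    = ≤-refl
  fromℕ-nonNeg (suc n) = +-nonNeg 0≤1 (fromℕ-nonNeg n)

  fromℕ-mono : ∀ {m n} → m ℕ.≤ n → fromℕ m ≤ fromℕ n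
  fromℕ-mono {n = n} z≤n = fromℕ-nonNeg n
  fromℕ-mono (s≤s m≤n)   = +-mono-≤ ≤-refl (fromℕ-mono m≤n)

  1≤fromℕ : ∀ {n} → 1 ℕ.≤ n → 1# ≤ fromℕ n
  1≤fromℕ 1≤n = ≤-respˡ-≈ (+-identityʳ 1#) (fromℕ-mono 1≤n)

  -- If the naturals had a supremum `s`, then `s - 1#` would bound them too, since each `suc n` lies
  -- below `s`.
  archimedean : ∀ x → ¬ (∀ n → fromℕ n ≤ x)
  archimedean x bounded = 1≰0 $ begin
    1#                ≈⟨ solve 1 (λ s → 𝟙 := s :+ (𝟙 :- s)) refl s ⟩
    s + (1# - s)      ≤⟨ +-mono-≤ (least below) ≤-refl ⟩
    s - 1# + (1# - s) ≈⟨ solve 1 (λ s → s :- 𝟙 :+ (𝟙 :- s) := 𝟘) refl s ⟩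
    0#                ∎
    where
    open ≤-Reasoning
    P : Carrier → Set
    P y = ∃ λ n → y ≈ fromℕ n
    s-sup : ∃ (IsSupremum _≤_ P)
    s-sup = complete P (0# , 0 , refl) (x , λ { (n , eq) → ≤-respˡ-≈ (sym eq) (bounded n) })
    s = proj₁ s-sup
    open IsSupremum (proj₂ s-sup)
    below : UpperBound _≤_ P (s - 1#)
    below {y} (n , eq) = ≤-by {d = s - (1# + y)} (0≤y-x (upper (suc n , +-congˡ eq)))
      (solve 2 (λ s y → s :- 𝟙 := y :+ (s :- (𝟙 :+ y))) refl s y)

-- Finite sums and the Kronecker delta.

module FiniteSum (ℝ : CompleteOrderedField) where
  open CompleteOrderedField ℝ hiding (zero)
  open OrderedField ℝ
  open SemiringSum semiring public
  open SDP₂ ℝ using (I)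
  open import Relation.Binary.Reasoning.Setoid setoid

  private
    variable
      m n : ℕ

  sum-cong : ∀ n {f g : Vector Carrier n} → (∀ i → f i ≈ g i) → sum f ≈ sum g
  sum-cong n = sum-cong-≋

  sum-≤ : ∀ n {f g : Vector Carrier n} → (∀ i → f i ≤ g i) → sum f ≤ sum g
  sum-≤ zero    f≤g = ≤-refl
  sum-≤ (suc n) f≤g = +-mono-≤ (f≤g zero) (sum-≤ n (f≤g ∘ suc))

  sum-0 : ∀ n → sum {n} (λ _ → 0#) ≈ 0#
  sum-0 = sum-replicate-zero

  sum-nonNeg : ∀ n {f : Vector Carrier n} → (∀ i → 0# ≤ f i) → 0# ≤ sum f
  sum-nonNeg n 0≤f = ≤-respˡ-≈ (sum-0 n) (sum-≤ n 0≤f)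

  term≤sum : ∀ n {f : Vector Carrier n} → (∀ i → 0# ≤ f i) → ∀ i → f i ≤ sum f
  term≤sum (suc n) 0≤f zero    = ≤-by (sum-nonNeg n (0≤f ∘ suc)) refl
  term≤sum (suc n) 0≤f (suc i) =
    ≤-trans (term≤sum n (0≤f ∘ suc) i) (≤-by (0≤f zero) (+-comm _ _))

  sum-const : ∀ n x → sum {n} (λ _ → x) ≈ fromℕ n * x
  sum-const zero    x = sym (zeroˡ x)
  sum-const (suc n) x = begin
    x + sum {n} (λ _ → x)  ≈⟨ +-congˡ (sum-const n x) ⟩
    x + fromℕ n * x        ≈⟨ solve 2 (λ n x → x :+ n :* x := (con (+ 1) :+ n) :* x) refl (fromℕ n) x ⟩
    (1# + fromℕ n) * x     ∎

  sum-1 : ∀ n → sum {n} (λ _ → 1#) ≈ fromℕ n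
  sum-1 n = trans (sum-const n 1#) (*-identityʳ _)

  sum-+ : ∀ n (f g : Vector Carrier n) → sum (λ i → f i + g i) ≈ sum f + sum g
  sum-+ n = ∑-distrib-+

  sum-*ˡ : ∀ n x (f : Vector Carrier n) → sum (λ i → x * f i) ≈ x * sum f
  sum-*ˡ n x f = sym (*-distribˡ-sum x f)

  sum-*ʳ : ∀ n x (f : Vector Carrier n) → sum (λ i → f i * x) ≈ sum f * x
  sum-*ʳ n x f = sym (*-distribʳ-sum x f)

  sum-neg : ∀ n (f : Vector Carrier n) → sum (λ i → - f i) ≈ - sum f
  sum-neg zero    f = solve 0 (con (+ 0) := :- con (+ 0)) refl
  sum-neg (suc n) f = trans (+-congˡ (sum-neg n (f ∘ suc)))
    (solve 2 (λ x y → :- x :+ :- y := :- (x :+ y)) refl _ _)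

  sum-- : ∀ n (f g : Vector Carrier n) → sum (λ i → f i - g i) ≈ sum f - sum g
  sum-- n f g = trans (sum-+ n f (λ i → - g i)) (+-congˡ (sum-neg n g))

  sum-swap : ∀ m n (f : Fin m → Fin n → Carrier) →
             sum (λ i → sum (λ j → f i j)) ≈ sum (λ j → sum (λ i → f i j))
  sum-swap m n = ∑-comm

  sum-*-sum : ∀ m n (f : Vector Carrier m) (g : Vector Carrier n) →
              sum (λ i → sum (λ j → f i * g j)) ≈ sum f * sum g
  sum-*-sum m n f g = trans (sum-cong m λ i → sum-*ˡ n (f i) g) (sum-*ʳ m (sum g) f)

  sum₂-cong : ∀ m n {f g : Fin m → Fin n → Carrier} → (∀ i j → f i j ≈ g i j) →
              sum (λ i → sum (λ j → f i j)) ≈ sum (λ i → sum (λ j → g i j))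
  sum₂-cong m n f≈g = sum-cong m λ i → sum-cong n (f≈g i)

  sum₂-≤ : ∀ m n {f g : Fin m → Fin n → Carrier} → (∀ i j → f i j ≤ g i j) →
           sum (λ i → sum (λ j → f i j)) ≤ sum (λ i → sum (λ j → g i j))
  sum₂-≤ m n f≤g = sum-≤ m λ i → sum-≤ n (f≤g i)

  sum₂-nonNeg : ∀ m n {f : Fin m → Fin n → Carrier} → (∀ i j → 0# ≤ f i j) →
                0# ≤ sum (λ i → sum (λ j → f i j))
  sum₂-nonNeg m n 0≤f = sum-nonNeg m λ i → sum-nonNeg n (0≤f i)

  sum₂-+ : ∀ m n (f g : Fin m → Fin n → Carrier) →
           sum (λ i → sum (λ j → f i j + g i j)) ≈ sum (λ i → sum (λ j → f i j)) + sum (λ i → sum (λ j → g i j))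
  sum₂-+ m n f g = trans (sum-cong m λ i → sum-+ n (f i) (g i)) (sum-+ m _ _)

  sum₂-- : ∀ m n (f g : Fin m → Fin n → Carrier) →
           sum (λ i → sum (λ j → f i j - g i j)) ≈ sum (λ i → sum (λ j → f i j)) - sum (λ i → sum (λ j → g i j))
  sum₂-- m n f g = trans (sum-cong m λ i → sum-- n (f i) (g i)) (sum-- m _ _)

  sum₂-*ˡ : ∀ m n x (f : Fin m → Fin n → Carrier) →
            sum (λ i → sum (λ j → x * f i j)) ≈ x * sum (λ i → sum (λ j → f i j))
  sum₂-*ˡ m n x f = trans (sum-cong m λ i → sum-*ˡ n x (f i)) (sum-*ˡ m x _)

  sum-split : ∀ m n (f : Vector Carrier (m ℕ.+ n)) →
              sum f ≈ sum (λ i → f (i ↑ˡ n)) + sum (λ j → f (m ↑ʳ j))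
  sum-split zero    n f = sym (+-identityˡ _)
  sum-split (suc m) n f = trans (+-congˡ (sum-split m n (f ∘ suc))) (sym (+-assoc _ _ _))

  sum-combine : ∀ m n (f : Vector Carrier (m ℕ.* n)) →
                sum f ≈ sum {m} (λ i → sum {n} (λ j → f (combine i j)))
  sum-combine zero    n f = refl
  sum-combine (suc m) n f = trans (sum-split n (m ℕ.* n) f) (+-congˡ (sum-combine m n (f ∘ (n ↑ʳ_))))

  sum-remQuot : ∀ m n (f : Fin m → Fin n → Carrier) →
                sum {m ℕ.* n} (λ k → f (proj₁ (remQuot {m} n k)) (proj₂ (remQuot {m} n k))) ≈
                sum (λ i → sum (λ j → f i j))
  sum-remQuot m n f = trans (sum-combine m n _) (sum₂-cong m n λ i j →
    reflexive (≡.cong (uncurry f) (Fin.remQuot-combine {m} i j)))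

  I-refl : ∀ (i : Fin n) → I i i ≈ 1#
  I-refl i with i ≟ᶠ i
  ... | yes _  = refl
  ... | no i≢i = ⊥-elim (i≢i ≡.refl)

  I-sym : ∀ (i j : Fin n) → I i j ≈ I j i
  I-sym i j with i ≟ᶠ j | j ≟ᶠ i
  ... | yes _   | yes _   = refl
  ... | no _    | no _    = refl
  ... | yes i≡j | no j≢i  = ⊥-elim (j≢i (≡.sym i≡j))
  ... | no i≢j  | yes j≡i = ⊥-elim (i≢j (≡.sym j≡i))

  I-nonNeg : ∀ (i j : Fin n) → 0# ≤ I i j
  I-nonNeg i j with i ≟ᶠ j
  ... | yes _ = 0≤1
  ... | no _  = ≤-refl

  I-suc : ∀ (i j : Fin n) → I (suc i) (suc j) ≈ I i j
  I-suc i j with i ≟ᶠ j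
  ... | yes _ = refl
  ... | no _  = refl

  sum-I : ∀ (i : Fin n) (f : Vector Carrier n) → sum (λ j → I i j * f j) ≈ f i
  sum-I {suc n} zero f = begin
    1# * f zero + sum {n} (λ j → 0# * f (suc j))  ≈⟨ +-cong (*-identityˡ _) (trans (sum-cong n λ j → zeroˡ (f (suc j))) (sum-0 n)) ⟩
    f zero + 0#                                   ≈⟨ +-identityʳ _ ⟩
    f zero                                        ∎
  sum-I {suc n} (suc i) f = begin
    0# * f zero + sum {n} (λ j → I (suc i) (suc j) * f (suc j))
      ≈⟨ +-cong (zeroˡ _) (trans (sum-cong n λ j → *-congʳ (I-suc i j)) (sum-I i (f ∘ suc))) ⟩
    0# + f (suc i)                                ≈⟨ +-identityˡ _ ⟩
    f (suc i)                                     ∎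

-- Closed sets, projections and minima.

-- Compactness without sequences: the projection of a closed set along a bounded
-- interval is closed, because the infimum limit of the fibres over smaller and
-- smaller neighbourhoods of a point is attained in the fibre over that point.
module Compactness (em : ExcludedMiddle 0ℓ) (ℝ : CompleteOrderedField) where
  open CompleteOrderedField ℝ hiding (zero)
  open OrderedField ℝ
  open FiniteSum ℝ
  open SDP₂ ℝ

  Positive : Carrier → Set
  Positive ε = 0# ≤ ε × ¬ (ε ≈ 0#)

  1-positive : Positive 1#
  1-positive = 0≤1 , λ 1≈0 → 0≉1 (sym 1≈0)

  ≰⇒≥ : ∀ {x y} → ¬ (x ≤ y) → y ≤ x
  ≰⇒≥ {x} {y} x≰y with total x y
  ... | inj₁ x≤y = ⊥-elim (x≰y x≤y)
  ... | inj₂ y≤x = y≤x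

  ¬∀≤⇒∃≥ : ∀ {P : Carrier → Set} {x} → ¬ (∀ {t} → P t → x ≤ t) → ∃ λ t → P t × t ≤ x
  ¬∀≤⇒∃≥ {P} {x} ¬all with em {∃ λ t → P t × t ≤ x}
  ... | yes found = found
  ... | no none   = ⊥-elim $ ¬all λ {t} Pt → ≰⇒≥ λ x≰t → none (t , Pt , x≰t)

  s+ε≰s : ∀ {s ε} → Positive ε → ¬ (s + ε ≤ s)
  s+ε≰s {s} {ε} (0≤ε , ε≉0) p = ε≉0 (antisym ε≤0 0≤ε)
    where
    open ≤-Reasoning
    ε≤0 : ε ≤ 0#
    ε≤0 = begin
      ε              ≈⟨ solve 2 (λ s ε → ε := s :+ ε :- s) refl s ε ⟩
      s + ε - s      ≤⟨ +-monoˡ-≤ (- s) p ⟩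
      s - s          ≈⟨ -‿inverseʳ s ⟩
      0#             ∎

  s≰s-ε : ∀ {s ε} → Positive ε → ¬ (s ≤ s - ε)
  s≰s-ε {s} {ε} ε>0 p = s+ε≰s {s - ε} ε>0
    (≤-respˡ-≈ (solve 2 (λ s ε → s := s :- ε :+ ε) refl s ε) p)

  -- If a - b > 0 then ε = (a - b) / (L + 1) violates the hypothesis.
  ≤-from-approximation : ∀ {a b L} → 0# ≤ L → (∀ ε → Positive ε → a ≤ b + L * ε) → a ≤ b
  ≤-from-approximation {a} {b} {L} 0≤L approx with em {a ≤ b}
  ... | yes a≤b = a≤b
  ... | no a≰b  = ⊥-elim (s+ε≰s {b + L * ε} ε>0 (≤-respˡ-≈ a≈ (approx ε ε>0)))
    where
    open import Relation.Binary.Reasoning.Setoid setoid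
    L+1≉0 : ¬ (1# + L ≈ 0#)
    L+1≉0 = 1≤⇒≉0 (≤-by 0≤L refl)
    L+1≥0 : 0# ≤ 1# + L
    L+1≥0 = +-nonNeg 0≤1 0≤L
    ε = (a - b) / (1# + L)
    [1+L]ε≈a-b : (1# + L) * ε ≈ a - b
    [1+L]ε≈a-b = begin
      (1# + L) * ((a - b) * (1# + L) ⁻¹)  ≈⟨ solve 3 (λ x d y → x :* (d :* y) := d :* (x :* y)) refl _ _ _ ⟩
      (a - b) * ((1# + L) * (1# + L) ⁻¹)  ≈⟨ *-congˡ (⁻¹-inverseʳ _ L+1≉0) ⟩
      (a - b) * 1#                        ≈⟨ *-identityʳ _ ⟩
      a - b                               ∎
    a≈ : a ≈ b + L * ε + ε
    a≈ = begin
      a                    ≈⟨ solve 2 (λ a b → a := b :+ (a :- b)) refl a b ⟩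
      b + (a - b)          ≈⟨ +-congˡ [1+L]ε≈a-b ⟨
      b + (1# + L) * ε     ≈⟨ solve 3 (λ b L ε → b :+ (con (+ 1) :+ L) :* ε := b :+ L :* ε :+ ε) refl b L ε ⟩
      b + L * ε + ε        ∎
    ε>0 : Positive ε
    ε>0 = *-nonNeg (0≤y-x (≰⇒≥ a≰b)) (⁻¹-nonNeg L+1≥0 L+1≉0) , λ ε≈0 → a≰b $ ≤-reflexive $ begin
      a                 ≈⟨ a≈ ⟩
      b + L * ε + ε     ≈⟨ +-cong (+-congˡ (*-congˡ ε≈0)) ε≈0 ⟩
      b + L * 0# + 0#   ≈⟨ solve 2 (λ b L → b :+ L :* con (+ 0) :+ con (+ 0) := b) refl b L ⟩
      b                 ∎

  -- In the instances below `Near ε` is closeness up to `ε` in every coordinate. Pointwise equal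
  -- points are near at every positive scale, so closed sets respect pointwise equality.
  record Space : Set₁ where
    field
      Point     : Set
      Near      : Carrier → Point → Point → Set
      Near-refl : ∀ {ε x} → 0# ≤ ε → Near ε x x
      Near-mono : ∀ {ε ε′ x y} → ε ≤ ε′ → Near ε x y → Near ε′ x y

  open Space

  Close : Carrier → Carrier → Carrier → Set
  Close ε x y = x ≤ y + ε × y ≤ x + ε

  line : Space
  line = record
    { Point = Carrier
    ; Near = Close
    ; Near-refl = λ 0≤ε → ≤-by 0≤ε refl , ≤-by 0≤ε refl
    ; Near-mono = λ ε≤ε′ (p , q) → ≤-trans p (+-mono-≤ ≤-refl ε≤ε′) , ≤-trans q (+-mono-≤ ≤-refl ε≤ε′)
    }

  infixr 5 _×ˢ_
  _×ˢ_ : Space → Space → Space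
  X ×ˢ Z = record
    { Point = Point X × Point Z
    ; Near = λ ε (x , z) (x′ , z′) → Near X ε x x′ × Near Z ε z z′
    ; Near-refl = λ 0≤ε → Near-refl X 0≤ε , Near-refl Z 0≤ε
    ; Near-mono = λ ε≤ε′ (p , q) → Near-mono X ε≤ε′ p , Near-mono Z ε≤ε′ q
    }

  _^ˢ : ℕ → Space
  d ^ˢ = record
    { Point = Vector Carrier d
    ; Near = λ ε x y → ∀ k → Close ε (x k) (y k)
    ; Near-refl = λ 0≤ε k → Near-refl line 0≤ε
    ; Near-mono = λ ε≤ε′ p k → Near-mono line ε≤ε′ (p k)
    }

  Closed : (X : Space) → (Point X → Set) → Set
  Closed X K = ∀ x → (∀ ε → Positive ε → ∃ λ y → Near X ε x y × K y) → K x

  module _ (X : Space) {K : Point X × Carrier → Set} (closed : Closed (X ×ˢ line) K)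
           {M} (bounded : ∀ {x t} → K (x , t) → 0# ≤ t × t ≤ M) where

    project-closed : Closed X (λ x → ∃ λ t → K (x , t))
    project-closed x near = s , closed (x , s) witness
      where
      BoundNear : Carrier → Carrier → Set
      BoundNear b ε = ∀ {y t} → Near X ε x y → K (y , t) → b ≤ t
      P : Carrier → Set
      P b = ∃ λ ε → Positive ε × BoundNear b ε
      P-bounded : UpperBound _≤_ P M
      P-bounded (ε , ε>0 , b≤) with near ε ε>0
      ... | y , x~y , t , Kyt = ≤-trans (b≤ x~y Kyt) (proj₂ (bounded Kyt))
      supremum = complete P (0# , 1# , 1-positive , λ _ Kyt → proj₁ (bounded Kyt)) (M , P-bounded)
      s = proj₁ supremum
      open IsSupremum (proj₂ supremum)
      lower : ∀ ε → Positive ε → ∃ λ b → P b × s - ε ≤ b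
      lower ε ε>0 with em {∃ λ b → P b × s - ε ≤ b}
      ... | yes found = found
      ... | no none   = ⊥-elim $ s≰s-ε ε>0 $ least λ {b} Pb → ≰⇒≥ λ q → none (b , Pb , q)
      common : ∀ {ε₁ ε₂} → Positive ε₁ → Positive ε₂ → ∃ λ ε → Positive ε × ε ≤ ε₁ × ε ≤ ε₂
      common {ε₁} {ε₂} p₁ p₂ with total ε₁ ε₂
      ... | inj₁ ε₁≤ε₂ = ε₁ , p₁ , ≤-refl , ε₁≤ε₂
      ... | inj₂ ε₂≤ε₁ = ε₂ , p₂ , ε₂≤ε₁ , ≤-refl
      witness : ∀ ε → Positive ε → ∃ λ z → Near (X ×ˢ line) ε (x , s) z × K z
      witness ε ε>0 with lower ε ε>0
      ... | b , (ε₁ , ε₁>0 , b≤) , s-ε≤b with common ε>0 ε₁>0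
      ... | ε₂ , ε₂>0 , ε₂≤ε , ε₂≤ε₁
        -- `s + ε` exceeds the supremum of `P`, so it fails to bound the fibres over the
        -- `ε₂`-neighbourhood from below and some `t ≤ s + ε` occurs there. As `ε₂ ≤ ε₁`, still
        -- `b ≤ t`, which gives `s ≤ t + ε`.
        with ¬∀≤⇒∃≥ {λ t → ∃ λ y → Near X ε₂ x y × K (y , t)} {s + ε}
               (λ s+ε≤ → s+ε≰s ε>0 (upper (ε₂ , ε₂>0 , λ x~y Kyt → s+ε≤ (_ , x~y , Kyt))))
      ... | t , (y , x~y , Kyt) , t≤s+ε =
        (y , t) , (Near-mono X ε₂≤ε x~y , s≤t+ε , t≤s+ε) , Kyt
        where
        open ≤-Reasoning
        s≤t+ε : s ≤ t + ε
        s≤t+ε = begin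
          s          ≈⟨ solve 2 (λ s ε → s := s :- ε :+ ε) refl s ε ⟩
          s - ε + ε  ≤⟨ +-monoˡ-≤ ε (≤-trans s-ε≤b (b≤ (Near-mono X ε₂≤ε₁ x~y) Kyt)) ⟩
          t + ε      ∎

  -- Induction on the dimension: one bounded coordinate is projected away at a time.
  project-vector-closed : ∀ (X : Space) {d} {K : Point X × Vector Carrier d → Set} →
    Closed (X ×ˢ d ^ˢ) K → ∀ {M} → (∀ {x y} → K (x , y) → ∀ k → 0# ≤ y k × y k ≤ M) →
    Closed X (λ x → ∃ λ y → K (x , y))
  project-vector-closed X {zero} closed bounded x near = (λ ()) , closed (x , λ ()) λ ε ε>0 →
    let (x′ , x~x′ , y , Kx′y) = near ε ε>0 in (x′ , y) , (x~x′ , λ ()) , Kx′y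
  project-vector-closed X {suc d} {K} closed bounded x near =
    let (y , t , Kxty) = project-vector-closed X
          (project-closed (X ×ˢ d ^ˢ) {λ ((x , y) , t) → K (x , t ∷ y)} closed′ (λ p → bounded p zero))
          (λ (t , p) k → bounded p (suc k)) x near′
    in t ∷ y , Kxty
    where
    closed′ : Closed ((X ×ˢ d ^ˢ) ×ˢ line) (λ ((x , y) , t) → K (x , t ∷ y))
    closed′ ((x , y) , t) near = closed (x , t ∷ y) λ ε ε>0 →
      let (((x′ , y′) , t′) , ((x~x′ , y~y′) , t~t′) , p) = near ε ε>0
      in (x′ , t′ ∷ y′) , (x~x′ , λ { zero → t~t′ ; (suc k) → y~y′ k }) , p
    near′ : ∀ ε → Positive ε → ∃ λ x′ → Near X ε x x′ × ∃ λ y → ∃ λ t → K (x′ , t ∷ y)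
    near′ ε ε>0 with near ε ε>0
    ... | x′ , x~x′ , y , Kx′y = x′ , x~x′ , (y ∘ suc) , y zero ,
      -- `y` and `y zero ∷ (y ∘ suc)` agree only pointwise; closedness carries `K` from one to the
      -- other.
      closed (x′ , y zero ∷ (y ∘ suc)) λ ε′ (0≤ε′ , _) →
        (x′ , y) ,
        (Near-refl X 0≤ε′ , λ { zero → Near-refl line 0≤ε′ ; (suc k) → Near-refl line 0≤ε′ }) ,
        Kx′y

  minimum-exists : ∀ {W : Carrier → Set} → Closed line W → ∃ W → (∀ {t} → W t → 0# ≤ t) →
                   ∃ (IsMinimum _≤_ W)
  minimum-exists {W} closed (t₀ , Wt₀) 0≤W = s , record { attained = closed s witness ; lowerBound = s≤ }
    where
    P : Carrier → Set
    P b = ∀ {t} → W t → b ≤ t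
    supremum = complete P (0# , 0≤W) (t₀ , λ Pb → Pb Wt₀)
    s = proj₁ supremum
    open IsSupremum (proj₂ supremum)
    s≤ : P s
    s≤ Wt = least (λ Pb → Pb Wt)
    witness : ∀ ε → Positive ε → ∃ λ t → Close ε s t × W t
    witness ε ε>0 with ¬∀≤⇒∃≥ {W} {s + ε} (λ p → s+ε≰s ε>0 (upper p))
    ... | t , Wt , t≤s+ε = t , (≤-trans (s≤ Wt) (≤-by (proj₁ ε>0) refl) , t≤s+ε) , Wt

  module _ (X : Space) where

    -- A global constant is available because all constraints are linear in the value and the matrix
    -- entries, semidefiniteness being a family of linear inequalities indexed by test vectors.
    Lipschitz : (Point X → Carrier) → Set
    Lipschitz f = ∃ λ L → 0# ≤ L × ∀ {ε x y} → 0# ≤ ε → Near X ε x y → Close (L * ε) (f x) (f y)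

    Lipschitz-const : ∀ c → Lipschitz (λ _ → c)
    Lipschitz-const c = 0# , ≤-refl , λ 0≤ε _ → Near-refl line (*-nonNeg ≤-refl 0≤ε)

    Lipschitz-+ : ∀ {f g} → Lipschitz f → Lipschitz g → Lipschitz (λ x → f x + g x)
    Lipschitz-+ {f} {g} (L , 0≤L , fL) (M , 0≤M , gM) =
      L + M , +-nonNeg 0≤L 0≤M , λ {ε} 0≤ε x~y →
        let (p , p′) = fL 0≤ε x~y
            (q , q′) = gM 0≤ε x~y
        in ≤-respʳ-≈ (rearrange _ _ L M ε) (+-mono-≤ p q) ,
           ≤-respʳ-≈ (rearrange _ _ L M ε) (+-mono-≤ p′ q′)
      where
      rearrange : ∀ a b L M ε → a + L * ε + (b + M * ε) ≈ a + b + (L + M) * ε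
      rearrange = solve 5 (λ a b L M ε → a :+ L :* ε :+ (b :+ M :* ε) := a :+ b :+ (L :+ M) :* ε) refl

    Lipschitz-*ˡ : ∀ c {f} → Lipschitz f → Lipschitz (λ x → c * f x)
    Lipschitz-*ˡ c {f} (L , 0≤L , fL) with total 0# c
    ... | inj₁ 0≤c = c * L , *-nonNeg 0≤c 0≤L , λ 0≤ε x~y →
      let (p , p′) = fL 0≤ε x~y in scale p , scale p′
      where
      scale : ∀ {a b ε} → a ≤ b + L * ε → c * a ≤ c * b + c * L * ε
      scale {a} {b} {ε} p = ≤-respʳ-≈
        (solve 4 (λ b c L ε → c :* (b :+ L :* ε) := c :* b :+ c :* L :* ε) refl b c L ε)
        (*-monoʳ-≤ 0≤c p)
    ... | inj₂ c≤0 = - c * L , *-nonNeg (neg-nonNeg c≤0) 0≤L , λ 0≤ε x~y →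
      let (p , p′) = fL 0≤ε x~y in scale p′ , scale p
      where
      scale : ∀ {a b ε} → a ≤ b + L * ε → c * b ≤ c * a + (- c * L) * ε
      scale {a} {b} {ε} p = ≤-by (*-nonNeg (neg-nonNeg c≤0) (0≤y-x p))
        (solve 5 (λ a b c L ε → c :* a :+ (:- c :* L) :* ε := c :* b :+ :- c :* (b :+ L :* ε :- a)) refl a b c L ε)

    Lipschitz-cong : ∀ {f g} → (∀ x → f x ≈ g x) → Lipschitz f → Lipschitz g
    Lipschitz-cong f≈g (L , 0≤L , fL) = L , 0≤L , λ {ε} {x} {y} 0≤ε x~y →
      let (p , p′) = fL 0≤ε x~y
      in ≤-respˡ-≈ (f≈g x) (≤-respʳ-≈ (+-congʳ (f≈g y)) p) ,
         ≤-respˡ-≈ (f≈g y) (≤-respʳ-≈ (+-congʳ (f≈g x)) p′)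

    Lipschitz-*ʳ : ∀ c {f} → Lipschitz f → Lipschitz (λ x → f x * c)
    Lipschitz-*ʳ c f-Lipschitz = Lipschitz-cong (λ _ → *-comm c _) (Lipschitz-*ˡ c f-Lipschitz)

    Lipschitz-sum : ∀ {n} {f : Fin n → Point X → Carrier} → (∀ i → Lipschitz (f i)) →
                    Lipschitz (λ x → sum (λ i → f i x))
    Lipschitz-sum {zero}  fL = Lipschitz-const 0#
    Lipschitz-sum {suc n} fL = Lipschitz-+ (fL zero) (Lipschitz-sum (fL ∘ suc))

    ≤-closed : ∀ {f g} → Lipschitz f → Lipschitz g → Closed X (λ x → f x ≤ g x)
    ≤-closed {f} {g} (L , 0≤L , fL) (M , 0≤M , gM) x near =
      ≤-from-approximation (+-nonNeg 0≤L 0≤M) λ ε (0≤ε , ε≉0) →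
        let (y , x~y , fy≤gy) = near ε (0≤ε , ε≉0) in begin
        f x                    ≤⟨ proj₁ (fL 0≤ε x~y) ⟩
        f y + L * ε            ≤⟨ +-monoˡ-≤ (L * ε) fy≤gy ⟩
        g y + L * ε            ≤⟨ +-monoˡ-≤ (L * ε) (proj₂ (gM 0≤ε x~y)) ⟩
        g x + M * ε + L * ε    ≈⟨ solve 4 (λ a L M ε → a :+ M :* ε :+ L :* ε := a :+ (L :+ M) :* ε) refl _ L M ε ⟩
        g x + (L + M) * ε      ∎
      where open ≤-Reasoning

    closed-weaken : ∀ {K K′ : Point X → Set} → Closed X K′ → (∀ {x} → K x → K′ x) →
                    ∀ {x} → (∀ ε → Positive ε → ∃ λ y → Near X ε x y × K y) → K′ x
    closed-weaken closed′ K⇒K′ near = closed′ _ λ ε ε>0 →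
      let (y , x~y , Ky) = near ε ε>0 in y , x~y , K⇒K′ Ky

    ≈-closed : ∀ {f g} → Lipschitz f → Lipschitz g → Closed X (λ x → f x ≈ g x)
    ≈-closed {f} {g} f-L g-L x near = antisym
      (closed-weaken (≤-closed f-L g-L) ≤-reflexive near)
      (closed-weaken (≤-closed g-L f-L) (≤-reflexive ∘ sym) near)

-- Attainment of the minimum of the semidefinite program.

module Attainment (em : ExcludedMiddle 0ℓ) (ℝ : CompleteOrderedField) where
  open CompleteOrderedField ℝ hiding (zero)
  open OrderedField ℝ
  open FiniteSum ℝ
  open SDP₂ ℝ
  open Compactness em ℝ
  open Space
  matrices : ℕ → Space
  matrices n = record
    { Point = Matrix n n
    ; Near = λ ε A B → ∀ i j → Close ε (A i j) (B i j)
    ; Near-refl = λ 0≤ε i j → Near-refl line 0≤ε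
    ; Near-mono = λ ε≤ε′ p i j → Near-mono line ε≤ε′ (p i j)
    }

  module _ {n : ℕ} (r s : Fin (suc n)) (D : Matrix (suc n) (suc n)) where
    private
      n² = n ℕ.* n
      X : Space
      X = line ×ˢ matrices n²

      entry : ∀ i j → Lipschitz X (λ (_ , Y) → Y i j)
      entry i j = 1# , 0≤1 , λ {ε} 0≤ε (_ , x~y) →
        Near-mono line (≤-reflexive (sym (*-identityˡ ε))) (x~y i j)

      trace-Lipschitz : ∀ A → Lipschitz X (λ x → trace (A · proj₂ x))
      trace-Lipschitz A = Lipschitz-sum X λ i → Lipschitz-sum X λ j → Lipschitz-*ˡ X (A i j) (entry j i)

      const : ∀ c → Lipschitz X (λ _ → c)
      const = Lipschitz-const X

      value : Lipschitz X proj₁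
      value = 1# , 0≤1 , λ {ε} 0≤ε (v~w , _) → Near-mono line (≤-reflexive (sym (*-identityˡ ε))) v~w

      -- Keeping the objective value as a coordinate makes the set of values a projection along the
      -- bounded matrix entries, so that the minimisation takes place over a closed subset of the
      -- line.
      K : Point X → Set
      K (v , Y) = Feasible {n} Y × v ≈ objective r s D Y

      K-closed : Closed X K
      K-closed x near = record
        { nonnegative          = λ i j →
            limit (≤-closed X (const 0#) (entry i j)) λ (F , _) → Feasible.nonnegative F i j
        ; positiveSemidefinite =
            (λ i j → limit (≈-closed X (entry i j) (entry j i))
                       λ (F , _) → proj₁ (Feasible.positiveSemidefinite F) i j) ,
            (λ z → limit (≤-closed X (const 0#) (Lipschitz-sum X λ i → Lipschitz-sum X λ j →
                     Lipschitz-*ʳ X (z j) (Lipschitz-*ˡ X (z i) (entry i j))))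
                     λ (F , _) → proj₂ (Feasible.positiveSemidefinite F) z)
        ; inner                = λ j → limit (≈-closed X (trace-Lipschitz (I {n} ⊗ E j)) (const 1#)) λ (F , _) → Feasible.inner F j
        ; outer                = λ j → limit (≈-closed X (trace-Lipschitz (E j ⊗ I {n})) (const 1#)) λ (F , _) → Feasible.outer F j
        ; gangster             = limit (≈-closed X (trace-Lipschitz (I {n} ⊗ (J {n} ⊖ I) ⊕ (J {n} ⊖ I) ⊗ I {n})) (const 0#))
            λ (F , _) → Feasible.gangster F
        ; total                = limit (≈-closed X (trace-Lipschitz (J {n} ⊗ J {n})) (const (fromℕ (n ℕ.* n))))
            λ (F , _) → Feasible.total F
        } , limit (≈-closed X value (trace-Lipschitz
              (submatrix D (punchIn s) (punchIn s) ⊗ (½ *ₛ submatrix cycleAdjacency (punchIn r) (punchIn r))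
                ⊕ Diag (c̄ r s D)))) proj₂
        where
        limit : ∀ {K′ : Point X → Set} → Closed X K′ → (∀ {x} → K x → K′ x) → K′ x
        limit closed′ K⇒K′ = closed-weaken X closed′ K⇒K′ near

      -- `total` prescribes the sum of all entries, and the entries are nonnegative.
      entry-bound : ∀ {Y} → Feasible {n} Y → ∀ i j → Y i j ≤ fromℕ (n ℕ.* n)
      entry-bound {Y} F i j = begin
        Y i j                                        ≤⟨ term≤sum n² (λ k → nonnegative k j) i ⟩
        sum (λ k → Y k j)                            ≤⟨ term≤sum n² (λ l → sum-nonNeg n² λ k → nonnegative k l) j ⟩
        sum (λ l → sum (λ k → Y k l))                ≈⟨ sum₂-cong n² n² (λ l k → 1*1* (Y k l)) ⟩
        trace ((J {n} ⊗ J {n}) · Y)                  ≈⟨ Feasible.total F ⟩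
        fromℕ (n ℕ.* n)                              ∎
        where
        open ≤-Reasoning
        open Feasible F using (nonnegative)
        1*1* : ∀ y → y ≈ 1# * 1# * y
        1*1* = solve 1 (λ y → y := con (+ 1) :* con (+ 1) :* y) refl

      flatten : Matrix n² n² → Vector Carrier (n² ℕ.* n²)
      flatten Y k = uncurry Y (remQuot n² k)

      unflatten : Vector Carrier (n² ℕ.* n²) → Matrix n² n²
      unflatten y i j = y (combine i j)

      -- The round trip returns `Y` only entrywise; closedness of `K` replaces extensionality.
      K-flatten : ∀ {v Y} → K (v , Y) → K (v , unflatten (flatten Y))
      K-flatten {v} {Y} KvY = K-closed (v , unflatten (flatten Y)) λ ε (0≤ε , _) →
        (v , Y) , (Near-refl line 0≤ε , λ i j →
          ≡.subst (λ p → Close ε (uncurry Y p) (Y i j)) (≡.sym (Fin.remQuot-combine i j)) (Near-refl line 0≤ε)) ,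
        KvY

      K-unflatten-closed : Closed (line ×ˢ (n² ℕ.* n²) ^ˢ) (λ (v , y) → K (v , unflatten y))
      K-unflatten-closed (v , y) near = K-closed (v , unflatten y) λ ε ε>0 →
        let ((v′ , y′) , (v~v′ , y~y′) , p) = near ε ε>0
        in (v′ , unflatten y′) , (v~v′ , λ i j → y~y′ (combine i j)) , p

      K-bounded : ∀ {v y} → K (v , unflatten y) → ∀ k → 0# ≤ y k × y k ≤ fromℕ (n ℕ.* n)
      K-bounded {y = y} (F , _) k =
        ≡.subst (λ l → 0# ≤ y l × y l ≤ fromℕ (n ℕ.* n)) (Fin.combine-remQuot {n²} n² k)
          (Feasible.nonnegative F _ _ , entry-bound F _ _)

      Value : Carrier → Set
      Value v = ∃ λ y → K (v , unflatten y)

      Value-closed : Closed line Value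
      Value-closed = project-vector-closed line {K = λ (v , y) → K (v , unflatten y)} K-unflatten-closed
        (λ {v} {y} → K-bounded {v} {y})

      minimum-unflatten : ∀ {m} → IsMinimum _≤_ Value m → IsOPT-SDP₂ r s D m
      minimum-unflatten isMin = record
        { attained = let (y , p) = IsMinimum.attained isMin in unflatten y , p
        ; lowerBound = λ (Y , p) → IsMinimum.lowerBound isMin (flatten Y , K-flatten p)
        }

    SDP₂-minimum-exists : ∀ {x} → IsSDP₂Value r s D x → (∀ {x} → IsSDP₂Value r s D x → 0# ≤ x) →
                          ∃ (IsOPT-SDP₂ r s D)
    SDP₂-minimum-exists {x} (Y , p) 0≤ =
      let (m , isMin) = minimum-exists {W = Value} Value-closed (flatten-value (Y , p)) (λ (y , p) → 0≤ (unflatten y , p))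
      in m , minimum-unflatten isMin
      where
      flatten-value : IsSDP₂Value r s D x → ∃ Value
      flatten-value (Y , p) = x , flatten Y , K-flatten p

-- Traces, quadratic forms and Kronecker products.

module Matrices (ℝ : CompleteOrderedField) where
  open CompleteOrderedField ℝ hiding (zero)
  open OrderedField ℝ
  open FiniteSum ℝ
  open SDP₂ ℝ
  open import Relation.Binary.Reasoning.Setoid setoid

  private
    variable
      m n : ℕ

  trace-⊕ˡ : ∀ (A B M : Matrix n n) → trace ((A ⊕ B) · M) ≈ trace (A · M) + trace (B · M)
  trace-⊕ˡ {n} A B M = trans (sum₂-cong n n λ i j → distribʳ (M j i) (A i j) (B i j)) (sum₂-+ n n _ _)

  trace-⊖ˡ : ∀ (A B M : Matrix n n) → trace ((A ⊖ B) · M) ≈ trace (A · M) - trace (B · M)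
  trace-⊖ˡ {n} A B M = trans
    (sum₂-cong n n λ i j → solve 3 (λ a b m → (a :- b) :* m := a :* m :- b :* m) refl (A i j) (B i j) (M j i))
    (sum₂-- n n _ _)

  trace-*ₛˡ : ∀ c (A M : Matrix n n) → trace ((c *ₛ A) · M) ≈ c * trace (A · M)
  trace-*ₛˡ {n} c A M = trans (sum₂-cong n n λ i j → *-assoc c (A i j) (M j i)) (sum₂-*ˡ n n c _)

  trace-comm : ∀ (A B : Matrix n n) → trace (A · B) ≈ trace (B · A)
  trace-comm {n} A B = trans (sum-swap n n _) (sum₂-cong n n λ i j → *-comm (A j i) (B i j))

  trace-⊕ʳ : ∀ (A B M : Matrix n n) → trace (M · (A ⊕ B)) ≈ trace (M · A) + trace (M · B)
  trace-⊕ʳ A B M = trans (trace-comm M (A ⊕ B)) (trans (trace-⊕ˡ A B M) (+-cong (trace-comm A M) (trace-comm B M)))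

  trace-⊖ʳ : ∀ (A B M : Matrix n n) → trace (M · (A ⊖ B)) ≈ trace (M · A) - trace (M · B)
  trace-⊖ʳ A B M = trans (trace-comm M (A ⊖ B)) (trans (trace-⊖ˡ A B M) (+-cong (trace-comm A M) (-‿cong (trace-comm B M))))

  trace-*ₛʳ : ∀ c (A M : Matrix n n) → trace (M · (c *ₛ A)) ≈ c * trace (M · A)
  trace-*ₛʳ c A M = trans (trace-comm M (c *ₛ A)) (trans (trace-*ₛˡ c A M) (*-congˡ (trace-comm A M)))

  sum-remQuot₂ : ∀ m n (f : Fin m → Fin n → Fin m → Fin n → Carrier) →
    sum {m ℕ.* n} (λ k → sum {m ℕ.* n} λ l → f (proj₁ (remQuot {m} n k)) (proj₂ (remQuot {m} n k))
                                              (proj₁ (remQuot {m} n l)) (proj₂ (remQuot {m} n l))) ≈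
    sum (λ u → sum λ i → sum λ v → sum (f u i v))
  sum-remQuot₂ m n f = trans (sum-remQuot m n (λ u i → sum {m ℕ.* n} λ l → f u i (proj₁ (remQuot {m} n l)) (proj₂ (remQuot {m} n l))))
    (sum₂-cong m n λ u i → sum-remQuot m n (f u i))

  -- Every constraint matrix is a Kronecker product or a sum of two, so this reduces feasibility to
  -- traces of small matrices.
  trace-⊗ : ∀ (A C : Matrix m m) (B D : Matrix n n) →
            trace ((A ⊗ B) · (C ⊗ D)) ≈ trace (A · C) * trace (B · D)
  trace-⊗ {m} {n} A C B D = begin
    trace ((A ⊗ B) · (C ⊗ D))
      ≈⟨ sum-remQuot₂ m n (λ u i v j → A u v * B i j * (C v u * D j i)) ⟩
    sum (λ u → sum λ i → sum λ v → sum λ j → A u v * B i j * (C v u * D j i))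
      ≈⟨ (sum₂-cong m n λ u i → sum₂-cong m n λ v j →
           solve 4 (λ a b c d → a :* b :* (c :* d) := a :* c :* (b :* d)) refl (A u v) (B i j) (C v u) (D j i)) ⟩
    sum (λ u → sum λ i → sum λ v → sum λ j → A u v * C v u * (B i j * D j i))
      ≈⟨ (sum₂-cong m n λ u i → sum-*-sum m n (λ v → A u v * C v u) (λ j → B i j * D j i)) ⟩
    sum (λ u → sum λ i → (A · C) u u * (B · D) i i)
      ≈⟨ sum-*-sum m n (λ u → (A · C) u u) (λ i → (B · D) i i) ⟩
    trace (A · C) * trace (B · D) ∎

  trace-I : ∀ (M : Matrix n n) → trace (I · M) ≈ trace M
  trace-I {n} M = sum-cong n λ i → sum-I i (λ j → M j i)

  trace-E : ∀ (M : Matrix n n) k → trace (E k · M) ≈ M k k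
  trace-E {n} M k = begin
    sum (λ i → sum λ j → I i k * I k j * M j i)
      ≈⟨ sum-cong n (λ i → trans (sum-cong n λ j → *-assoc (I i k) (I k j) (M j i)) (sum-*ˡ n (I i k) _)) ⟩
    sum (λ i → I i k * sum λ j → I k j * M j i)    ≈⟨ sum-cong n (λ i → *-cong (I-sym i k) (sum-I k (λ j → M j i))) ⟩
    sum (λ i → I k i * M k i)                      ≈⟨ sum-I k (M k) ⟩
    M k k                                          ∎

  trace-Diag : ∀ (d : Vector Carrier n) (M : Matrix n n) → trace (Diag d · M) ≈ sum (λ i → d i * M i i)
  trace-Diag {n} d M = sum-cong n λ i → trans
    (sum-cong n λ j → trans (*-congʳ (diag i j)) (*-assoc (I i j) (d i) (M j i)))
    (sum-I i (λ j → d i * M j i))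
    where
    diag : ∀ i j → Diag d i j ≈ I i j * d i
    diag i j with does (i ≟ᶠ j)
    ... | true  = sym (*-identityˡ _)
    ... | false = sym (zeroˡ _)

  trace-nonNeg : ∀ {A B : Matrix n n} → Nonnegative A → Nonnegative B → 0# ≤ trace (A · B)
  trace-nonNeg {n} 0≤A 0≤B = sum₂-nonNeg n n λ i j → *-nonNeg (0≤A i j) (0≤B j i)

  ⊗-nonNeg : ∀ {A : Matrix m m} {B : Matrix n n} → Nonnegative A → Nonnegative B → Nonnegative (A ⊗ B)
  ⊗-nonNeg 0≤A 0≤B p q = *-nonNeg (0≤A _ _) (0≤B _ _)

  ⟨_∣_∣_⟩ : Vector Carrier n → Matrix n n → Vector Carrier n → Carrier
  ⟨ x ∣ A ∣ y ⟩ = sum (λ i → sum (λ j → x i * A i j * y j))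

  ⟨⟩-sumˡ : ∀ (A : Matrix n n) (a : Vector Carrier m) (x : Fin m → Vector Carrier n) (y : Vector Carrier n) →
            ⟨ (λ i → sum λ u → a u * x u i) ∣ A ∣ y ⟩ ≈ sum (λ u → a u * ⟨ x u ∣ A ∣ y ⟩)
  ⟨⟩-sumˡ {n} {m} A a x y = begin
    sum (λ i → sum λ j → sum (λ u → a u * x u i) * A i j * y j)
      ≈⟨ (sum₂-cong n n λ i j → trans (*-assoc _ _ _) (trans (sym (sum-*ʳ m (A i j * y j) λ u → a u * x u i))
           (sum-cong m λ u → solve 4 (λ a x M y → a :* x :* (M :* y) := a :* (x :* M :* y)) refl (a u) (x u i) (A i j) (y j)))) ⟩
    sum (λ i → sum λ j → sum λ u → a u * (x u i * A i j * y j))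
      ≈⟨ sum-cong n (λ i → sum-swap n m _) ⟩
    sum (λ i → sum λ u → sum λ j → a u * (x u i * A i j * y j))
      ≈⟨ sum-swap n m _ ⟩
    sum (λ u → sum λ i → sum λ j → a u * (x u i * A i j * y j))
      ≈⟨ (sum-cong m λ u → sum₂-*ˡ n n (a u) _) ⟩
    sum (λ u → a u * ⟨ x u ∣ A ∣ y ⟩) ∎

  ⟨⟩-comm : ∀ {A : Matrix n n} → Symmetric A → ∀ x y → ⟨ x ∣ A ∣ y ⟩ ≈ ⟨ y ∣ A ∣ x ⟩
  ⟨⟩-comm {n} {A = A} A-sym x y = trans (sum-swap n n _) $ sum₂-cong n n λ j i →
    trans (*-congʳ (*-congˡ (A-sym i j)))
      (solve 3 (λ x a y → x :* a :* y := y :* a :* x) refl (x i) (A j i) (y j))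

  ⟨⟩-⊕ : ∀ (A B : Matrix n n) x y → ⟨ x ∣ A ⊕ B ∣ y ⟩ ≈ ⟨ x ∣ A ∣ y ⟩ + ⟨ x ∣ B ∣ y ⟩
  ⟨⟩-⊕ {n} A B x y = trans (sum₂-cong n n λ i j →
      solve 4 (λ x a b y → x :* (a :+ b) :* y := x :* a :* y :+ x :* b :* y) refl (x i) (A i j) (B i j) (y j))
    (sum₂-+ n n _ _)

  ⟨⟩-*ₛ : ∀ c (A : Matrix n n) x y → ⟨ x ∣ c *ₛ A ∣ y ⟩ ≈ c * ⟨ x ∣ A ∣ y ⟩
  ⟨⟩-*ₛ {n} c A x y = trans (sum₂-cong n n λ i j →
      solve 4 (λ x c a y → x :* (c :* a) :* y := c :* (x :* a :* y)) refl (x i) c (A i j) (y j))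
    (sum₂-*ˡ n n c _)

  ⟨⟩-cong : ∀ {A B : Matrix n n} → (∀ i j → A i j ≈ B i j) → ∀ x y → ⟨ x ∣ A ∣ y ⟩ ≈ ⟨ x ∣ B ∣ y ⟩
  ⟨⟩-cong {n} A≈B x y = sum₂-cong n n λ i j → *-congʳ (*-congˡ (A≈B i j))

  PSD-⊕ : ∀ {A B : Matrix n n} → PositiveSemidefinite A → PositiveSemidefinite B → PositiveSemidefinite (A ⊕ B)
  PSD-⊕ {A = A} {B} (A-sym , 0≤A) (B-sym , 0≤B) =
    (λ i j → +-cong (A-sym i j) (B-sym i j)) ,
    λ x → ≤-respʳ-≈ (sym (⟨⟩-⊕ A B x x)) (+-nonNeg (0≤A x) (0≤B x))

  PSD-*ₛ : ∀ {c} {A : Matrix n n} → 0# ≤ c → PositiveSemidefinite A → PositiveSemidefinite (c *ₛ A)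
  PSD-*ₛ {c = c} {A} 0≤c (A-sym , 0≤A) =
    (λ i j → *-congˡ (A-sym i j)) , λ x → ≤-respʳ-≈ (sym (⟨⟩-*ₛ c A x x)) (*-nonNeg 0≤c (0≤A x))

  PSD-cong : ∀ {A B : Matrix n n} → (∀ i j → A i j ≈ B i j) → PositiveSemidefinite A → PositiveSemidefinite B
  PSD-cong A≈B (A-sym , 0≤A) =
    (λ i j → trans (sym (A≈B i j)) (trans (A-sym i j) (A≈B j i))) ,
    λ x → ≤-respʳ-≈ (⟨⟩-cong A≈B x x) (0≤A x)

  -- A symmetric A with A² = cA is the Gram matrix of its own rows, up to the factor c.
  PSD-projection-⊗ : ∀ {c} {A : Matrix m m} {B : Matrix n n} → 0# ≤ c → ¬ (c ≈ 0#) →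
    Symmetric A → (∀ u v → (A · A) u v ≈ c * A u v) → PositiveSemidefinite B →
    PositiveSemidefinite (A ⊗ B)
  PSD-projection-⊗ {m} {n} {c} {A} {B} 0≤c c≉0 A-sym A²≈cA (B-sym , 0≤B) =
    (λ k l → *-cong (A-sym _ _) (B-sym _ _)) ,
    λ x → *-cancelˡ-nonNeg 0≤c c≉0 (≤-respʳ-≈ (sym (expand x)) (sum-nonNeg m λ t → 0≤B (row x t)))
    where
    module _ (x : Vector Carrier (m ℕ.* n)) where
      y : Fin m → Vector Carrier n
      y u i = x (combine u i)
      β : Fin m → Fin m → Carrier
      β u v = ⟨ y u ∣ B ∣ y v ⟩
      row : Fin m → Vector Carrier n
      row t i = sum λ u → A t u * y u i
      row-form : ∀ t → ⟨ row t ∣ B ∣ row t ⟩ ≈ sum (λ u → sum λ v → A u t * A t v * β u v)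
      row-form t = begin
        ⟨ row t ∣ B ∣ row t ⟩
          ≈⟨ ⟨⟩-sumˡ B (A t) y (row t) ⟩
        sum (λ u → A t u * ⟨ y u ∣ B ∣ row t ⟩)
          ≈⟨ (sum-cong m λ u → *-cong (A-sym t u) (trans (⟨⟩-comm B-sym (y u) (row t))
               (trans (⟨⟩-sumˡ B (A t) y (y u)) (sum-cong m λ v → *-congˡ (⟨⟩-comm B-sym (y v) (y u)))))) ⟩
        sum (λ u → A u t * sum λ v → A t v * β u v)
          ≈⟨ (sum-cong m λ u → trans (sym (sum-*ˡ m (A u t) λ v → A t v * β u v))
               (sum-cong m λ v → sym (*-assoc (A u t) (A t v) (β u v)))) ⟩
        sum (λ u → sum λ v → A u t * A t v * β u v) ∎
      form : ⟨ x ∣ A ⊗ B ∣ x ⟩ ≈ sum (λ u → sum λ v → A u v * β u v)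
      form = begin
        ⟨ x ∣ A ⊗ B ∣ x ⟩
          ≈⟨ trans (sum-combine m n _) (sum₂-cong m n λ u i → sum-combine m n _) ⟩
        sum (λ u → sum λ i → sum λ v → sum λ j → y u i * (A ⊗ B) (combine u i) (combine v j) * y v j)
          ≈⟨ (sum₂-cong m n λ u i → sum₂-cong m n λ v j → trans (*-congʳ (*-congˡ (⊗-combine u i v j)))
               (solve 4 (λ x a b y → x :* (a :* b) :* y := a :* (x :* b :* y)) refl (y u i) (A u v) (B i j) (y v j))) ⟩
        sum (λ u → sum λ i → sum λ v → sum λ j → A u v * (y u i * B i j * y v j))
          ≈⟨ (sum-cong m λ u → sum-swap n m _) ⟩
        sum (λ u → sum λ v → sum λ i → sum λ j → A u v * (y u i * B i j * y v j))
          ≈⟨ (sum₂-cong m m λ u v → sum₂-*ˡ n n (A u v) _) ⟩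
        sum (λ u → sum λ v → A u v * β u v) ∎
        where
        ⊗-combine : ∀ u i v j → (A ⊗ B) (combine u i) (combine v j) ≈ A u v * B i j
        ⊗-combine u i v j = reflexive (≡.cong₂ (λ (u , i) (v , j) → A u v * B i j)
          (Fin.remQuot-combine u i) (Fin.remQuot-combine v j))
      expand : c * ⟨ x ∣ A ⊗ B ∣ x ⟩ ≈ sum (λ t → ⟨ row t ∣ B ∣ row t ⟩)
      expand = begin
        c * ⟨ x ∣ A ⊗ B ∣ x ⟩
          ≈⟨ trans (*-congˡ form) (sym (sum₂-*ˡ m m c _)) ⟩
        sum (λ u → sum λ v → c * (A u v * β u v))
          ≈⟨ (sum₂-cong m m λ u v → trans (sym (*-assoc _ _ _)) (trans (*-congʳ (sym (A²≈cA u v)))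
               (sym (sum-*ʳ m (β u v) λ t → A u t * A t v)))) ⟩
        sum (λ u → sum λ v → sum λ t → A u t * A t v * β u v)
          ≈⟨ trans (sum-cong m λ u → sum-swap m m _) (sum-swap m m _) ⟩
        sum (λ t → sum λ u → sum λ v → A u t * A t v * β u v)
          ≈⟨ sum-cong m (λ t → sym (row-form t)) ⟩
        sum (λ t → ⟨ row t ∣ B ∣ row t ⟩) ∎

  0≤x+x⇒0≤x : ∀ {x} → 0# ≤ x + x → 0# ≤ x
  0≤x+x⇒0≤x {x} 0≤2x with total 0# x
  ... | inj₁ 0≤x = 0≤x
  ... | inj₂ x≤0 = ≤-trans 0≤2x (≤-respʳ-≈ (+-identityˡ x) (+-monoˡ-≤ x x≤0))

  -- The matrix is the Laplacian of the graph with weights `W`: twice its form is the sum of the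
  -- `W i j` times the squares of `x i - x j`.
  Laplacian-PSD : ∀ {ρ} {W : Matrix n n} → Symmetric W → Nonnegative W → (∀ i → sum (W i) ≈ ρ) →
                  PositiveSemidefinite (ρ *ₛ I ⊖ W)
  Laplacian-PSD {n} {ρ} {W} W-sym 0≤W row-sum =
    (λ i j → +-cong (*-congˡ (I-sym i j)) (-‿cong (W-sym i j))) ,
    λ x → 0≤x+x⇒0≤x (≤-respʳ-≈ (sym (form x))
      (sum₂-nonNeg n n λ i j → *-nonNeg (0≤W i j) (square-nonNeg (x i - x j))))
    where
    module _ (x : Vector Carrier n) where
      squares cross : Carrier
      squares = sum λ i → ρ * (x i * x i)
      cross = ⟨ x ∣ W ∣ x ⟩
      left : sum (λ i → sum λ j → W i j * (x i * x i)) ≈ squares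
      left = sum-cong n λ i → trans (sum-*ʳ n (x i * x i) (W i)) (*-congʳ (row-sum i))
      right : sum (λ i → sum λ j → W i j * (x j * x j)) ≈ squares
      right = trans (sum-swap n n _) (trans (sum₂-cong n n λ i j → *-congʳ (W-sym j i)) left)
      quadratic : ⟨ x ∣ ρ *ₛ I ⊖ W ∣ x ⟩ ≈ squares - cross
      quadratic = trans (sum₂-cong n n λ i j → solve 5 (λ x y ρ δ w → x :* (ρ :* δ :- w) :* y := δ :* (ρ :* (x :* y)) :- x :* w :* y)
          refl (x i) (x j) ρ (I i j) (W i j))
        (trans (sum₂-- n n _ _) (+-congʳ (sum-cong n λ i → sum-I i (λ j → ρ * (x i * x j)))))
      form : ⟨ x ∣ ρ *ₛ I ⊖ W ∣ x ⟩ + ⟨ x ∣ ρ *ₛ I ⊖ W ∣ x ⟩ ≈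
             sum (λ i → sum λ j → W i j * ((x i - x j) * (x i - x j)))
      form = begin
        ⟨ x ∣ ρ *ₛ I ⊖ W ∣ x ⟩ + ⟨ x ∣ ρ *ₛ I ⊖ W ∣ x ⟩
          ≈⟨ +-cong quadratic quadratic ⟩
        squares - cross + (squares - cross)
          ≈⟨ solve 2 (λ s c → s :- c :+ (s :- c) := s :+ s :- (c :+ c)) refl squares cross ⟩
        squares + squares - (cross + cross)
          ≈⟨ +-cong (+-cong left right) (-‿cong (sum₂-+ n n _ _)) ⟨
        sum (λ i → sum λ j → W i j * (x i * x i)) + sum (λ i → sum λ j → W i j * (x j * x j))
          - sum (λ i → sum λ j → x i * W i j * x j + x i * W i j * x j)
          ≈⟨ trans (sum₂-- n n _ _) (+-congʳ (sum₂-+ n n _ _)) ⟨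
        sum (λ i → sum λ j → W i j * (x i * x i) + W i j * (x j * x j) - (x i * W i j * x j + x i * W i j * x j))
          ≈⟨ (sum₂-cong n n λ i j → solve 3 (λ w x y → w :* (x :* x) :+ w :* (y :* y) :- (x :* w :* y :+ x :* w :* y)
               := w :* ((x :- y) :* (x :- y))) refl (W i j) (x i) (x j)) ⟩
        sum (λ i → sum λ j → W i j * ((x i - x j) * (x i - x j))) ∎

  -- The Laplacian of the complete graph, tested on `z`.
  cauchy-schwarz : ∀ (z : Vector Carrier n) → sum z * sum z ≤ fromℕ n * sum (λ i → z i * z i)
  cauchy-schwarz {n} z = x≤y $ ≤-respʳ-≈ expand
    (proj₂ (Laplacian-PSD {ρ = fromℕ n} {W = J} (λ _ _ → refl) (λ _ _ → 0≤1) (λ _ → sum-1 n)) z)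
    where
    expand : ⟨ z ∣ fromℕ n *ₛ I ⊖ J ∣ z ⟩ ≈ fromℕ n * sum (λ i → z i * z i) - sum z * sum z
    expand = begin
      ⟨ z ∣ fromℕ n *ₛ I ⊖ J ∣ z ⟩
        ≈⟨ (sum₂-cong n n λ i j → solve 4 (λ x y ν δ → x :* (ν :* δ :- con (+ 1)) :* y := δ :* (ν :* (x :* y)) :- x :* y)
             refl (z i) (z j) (fromℕ n) (I i j)) ⟩
      sum (λ i → sum λ j → I i j * (fromℕ n * (z i * z j)) - z i * z j)
        ≈⟨ (trans (sum₂-- n n _ _) (+-congʳ (sum-cong n λ i → sum-I i λ j → fromℕ n * (z i * z j)))) ⟩
      sum (λ i → fromℕ n * (z i * z i)) - sum (λ i → sum λ j → z i * z j)
        ≈⟨ +-cong (sum-*ˡ n (fromℕ n) _) (-‿cong (sum-*-sum n n z z)) ⟩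
      fromℕ n * sum (λ i → z i * z i) - sum z * sum z ∎

-- Kernels and cyclic autocorrelations.

module Kernels (ℝ : CompleteOrderedField) where
  open CompleteOrderedField ℝ hiding (zero)
  open OrderedField ℝ
  open FiniteSum ℝ
  open Matrices ℝ
  open SDP₂ ℝ

  4# : Carrier
  4# = 1# + 1# + 1# + 1#

  -- κ i j plays the probability that positions i and j of the path carry vertices
  -- of the same group, when the vertices are split into k groups of size b.
  record Kernel (k b : ℕ) .{{_ : NonZero (k ℕ.* b)}} : Set where
    private
      n = k ℕ.* b
    field
      κ           : Matrix n n
      κ-sym       : Symmetric κ
      κ-nonNeg    : Nonnegative κ
      κ≤1         : ∀ i j → κ i j ≤ 1#
      κ-diag      : ∀ i → κ i i ≈ 1#
      κ-row       : ∀ i → sum (κ i) ≈ fromℕ b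
      kκ-J-PSD    : PositiveSemidefinite (fromℕ k *ₛ κ ⊖ J)
      -- Neighbours are taken modulo `n`. A defect of order `1/n` keeps the sum over all `n`
      -- positions bounded, and `4#` is the constant that the tent yields.
      κ-step      : ∀ i j → toℕ j ≡ suc (toℕ i) % n → fromℕ n * (1# - κ i j) ≤ 4#

  sum-shift₁ : ∀ n (g : ℕ → Carrier) →
               sum {n} (λ t → g (suc (toℕ t))) + g 0 ≈ sum {n} (λ t → g (toℕ t)) + g n
  sum-shift₁ zero    g = refl
  sum-shift₁ (suc n) g = begin
    g 1 + sum {n} (λ t → g (suc (suc (toℕ t)))) + g 0    ≈⟨ swap₁ _ _ _ ⟩
    g 0 + (sum {n} (λ t → g (suc (suc (toℕ t)))) + g 1)  ≈⟨ +-congˡ (sum-shift₁ n (g ∘ suc)) ⟩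
    g 0 + (sum {n} (λ t → g (suc (toℕ t))) + g (suc n))  ≈⟨ +-assoc _ _ _ ⟨
    g 0 + sum {n} (λ t → g (suc (toℕ t))) + g (suc n)    ∎
    where
    open import Relation.Binary.Reasoning.Setoid setoid
    swap₁ : ∀ x y z → x + y + z ≈ z + (y + x)
    swap₁ = solve 3 (λ x y z → x :+ y :+ z := z :+ (y :+ x)) refl

  -- Each unit shift trades the term `G i` for `G (n + i)`, which periodicity makes equal.
  sum-shift : ∀ n (G : ℕ → Carrier) → (∀ t → G (t ℕ.+ n) ≈ G t) →
              ∀ i → sum {n} (λ t → G (toℕ t ℕ.+ i)) ≈ sum {n} (λ t → G (toℕ t))
  sum-shift n G periodic zero    = sum-cong n λ t → reflexive (≡.cong G (ℕ.+-identityʳ (toℕ t)))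
  sum-shift n G periodic (suc i) = begin
    sum {n} (λ t → G (toℕ t ℕ.+ suc i))                 ≈⟨ (sum-cong n λ t → reflexive (≡.cong G (ℕ.+-suc (toℕ t) i))) ⟩
    sum {n} (λ t → g (suc (toℕ t)))                     ≈⟨ cancel _ (g 0) ⟩
    sum {n} (λ t → g (suc (toℕ t))) + g 0 - g 0         ≈⟨ +-congʳ (sum-shift₁ n g) ⟩
    sum {n} (λ t → g (toℕ t)) + g n - g 0               ≈⟨ +-congʳ (+-congˡ (trans (reflexive (≡.cong G (ℕ.+-comm n i))) (periodic i))) ⟩
    sum {n} (λ t → g (toℕ t)) + g 0 - g 0               ≈⟨ cancel _ (g 0) ⟨
    sum {n} (λ t → g (toℕ t))                           ≈⟨ sum-shift n G periodic i ⟩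
    sum {n} (λ t → G (toℕ t))                           ∎
    where
    open import Relation.Binary.Reasoning.Setoid setoid
    g : ℕ → Carrier
    g t = G (t ℕ.+ i)
    cancel : ∀ x y → x ≈ x + y - y
    cancel = solve 2 (λ x y → x := x :+ y :- y) refl

  module Autocorrelation (n : ℕ) (G : ℕ → Carrier) (periodic : ∀ t → G (t ℕ.+ n) ≈ G t)
                         (0≤G : ∀ t → 0# ≤ G t) where
    open import Relation.Binary.Reasoning.Setoid setoid

    -- Column `i` of `Φ` is `G` shifted by `i`, and `F` is the Gram matrix of the columns:
    -- semidefinite, with constant diagonal and constant row sums.
    Φ F : Matrix n n
    Φ t i = G (toℕ t ℕ.+ toℕ i)
    F i j = sum λ t → Φ t i * Φ t j

    S₁ S₂ V : Carrier
    S₁ = sum {n} λ t → G (toℕ t)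
    S₂ = sum {n} λ t → G (toℕ t) * G (toℕ t)
    V  = sum {n} λ t → (G (toℕ t) - G (suc (toℕ t))) * (G (toℕ t) - G (suc (toℕ t)))

    Φ-column : ∀ i → sum (λ t → Φ t i) ≈ S₁
    Φ-column i = sum-shift n G periodic (toℕ i)

    Φ-row : ∀ t → sum (Φ t) ≈ S₁
    Φ-row t = trans (sum-cong n λ i → reflexive (≡.cong G (ℕ.+-comm (toℕ t) (toℕ i)))) (Φ-column t)

    F-sym : Symmetric F
    F-sym i j = sum-cong n λ t → *-comm (Φ t i) (Φ t j)

    F-nonNeg : Nonnegative F
    F-nonNeg i j = sum-nonNeg n λ t → *-nonNeg (0≤G _) (0≤G _)

    F-diag : ∀ i → F i i ≈ S₂
    F-diag i = sum-shift n (λ t → G t * G t) (λ t → *-cong (periodic t) (periodic t)) (toℕ i)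

    F-row : ∀ i → sum (F i) ≈ S₁ * S₁
    F-row i = begin
      sum (λ j → sum λ t → Φ t i * Φ t j)   ≈⟨ sum-swap n n _ ⟩
      sum (λ t → sum λ j → Φ t i * Φ t j)   ≈⟨ (sum-cong n λ t → trans (sum-*ˡ n (Φ t i) (Φ t)) (*-congˡ (Φ-row t))) ⟩
      sum (λ t → Φ t i * S₁)                ≈⟨ sum-*ʳ n S₁ (λ t → Φ t i) ⟩
      sum (λ t → Φ t i) * S₁                ≈⟨ *-congʳ (Φ-column i) ⟩
      S₁ * S₁                               ∎

    F-form : ∀ x → ⟨ x ∣ F ∣ x ⟩ ≈ sum (λ t → sum (λ i → Φ t i * x i) * sum (λ i → Φ t i * x i))
    F-form x = begin
      sum (λ i → sum λ j → x i * F i j * x j)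
        ≈⟨ (sum₂-cong n n λ i j → trans (trans (*-assoc _ _ _) (*-comm _ _))
             (trans (*-assoc _ _ _) (sym (sum-*ʳ n (x j * x i) λ t → Φ t i * Φ t j)))) ⟩
      sum (λ i → sum λ j → sum λ t → Φ t i * Φ t j * (x j * x i))
        ≈⟨ (sum-cong n λ i → sum-swap n n _) ⟩
      sum (λ i → sum λ t → sum λ j → Φ t i * Φ t j * (x j * x i))
        ≈⟨ sum-swap n n _ ⟩
      sum (λ t → sum λ i → sum λ j → Φ t i * Φ t j * (x j * x i))
        ≈⟨ (sum-cong n λ t → trans (sum₂-cong n n λ i j →
             solve 4 (λ φ ψ y x → φ :* ψ :* (y :* x) := φ :* x :* (ψ :* y)) refl (Φ t i) (Φ t j) (x j) (x i))
             (sum-*-sum n n (λ i → Φ t i * x i) (λ j → Φ t j * x j))) ⟩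
      sum (λ t → sum (λ i → Φ t i * x i) * sum (λ i → Φ t i * x i)) ∎

    Φ-sum : ∀ x → sum (λ t → sum λ i → Φ t i * x i) ≈ S₁ * sum x
    Φ-sum x = begin
      sum (λ t → sum λ i → Φ t i * x i)   ≈⟨ sum-swap n n _ ⟩
      sum (λ i → sum λ t → Φ t i * x i)   ≈⟨ (sum-cong n λ i → trans (sum-*ʳ n (x i) λ t → Φ t i) (*-congʳ (Φ-column i))) ⟩
      sum (λ i → S₁ * x i)                ≈⟨ sum-*ˡ n S₁ x ⟩
      S₁ * sum x                          ∎

    -- The squared distance between two shifts of one function. For neighbouring positions it is
    -- quadratic in the slope of `G`.
    distance : ∀ i j → S₂ - F i j + (S₂ - F i j) ≈ sum (λ t → (Φ t i - Φ t j) * (Φ t i - Φ t j))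
    distance i j = sym $ begin
      sum (λ t → (Φ t i - Φ t j) * (Φ t i - Φ t j))
        ≈⟨ (sum-cong n λ t → solve 2 (λ x y → (x :- y) :* (x :- y) := x :* x :+ y :* y :- (x :* y :+ x :* y)) refl (Φ t i) (Φ t j)) ⟩
      sum (λ t → Φ t i * Φ t i + Φ t j * Φ t j - (Φ t i * Φ t j + Φ t i * Φ t j))
        ≈⟨ trans (sum-- n _ _) (+-cong (sum-+ n _ _) (-‿cong (sum-+ n _ _))) ⟩
      F i i + F j j - (F i j + F i j)
        ≈⟨ +-congʳ (+-cong (F-diag i) (F-diag j)) ⟩
      S₂ + S₂ - (F i j + F i j)
        ≈⟨ solve 2 (λ s f → s :+ s :- (f :+ f) := s :- f :+ (s :- f)) refl S₂ (F i j) ⟩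
      S₂ - F i j + (S₂ - F i j) ∎

    F≤S₂ : ∀ i j → F i j ≤ S₂
    F≤S₂ i j = x≤y $ 0≤x+x⇒0≤x $ ≤-respʳ-≈ (sym (distance i j)) $
      sum-nonNeg n λ t → square-nonNeg (Φ t i - Φ t j)

    distance-step : ∀ i j → (∀ t → G (t ℕ.+ toℕ j) ≈ G (suc t ℕ.+ toℕ i)) →
                    S₂ - F i j + (S₂ - F i j) ≈ V
    distance-step i j step = begin
      S₂ - F i j + (S₂ - F i j)
        ≈⟨ distance i j ⟩
      sum (λ t → (Φ t i - Φ t j) * (Φ t i - Φ t j))
        ≈⟨ (sum-cong n λ t → let e = +-congˡ { x = Φ t i } (-‿cong (step (toℕ t))) in *-cong e e) ⟩
      sum {n} (λ t → D (toℕ t ℕ.+ toℕ i))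
        ≈⟨ sum-shift n D (λ t → let e = +-cong (periodic t) (-‿cong (periodic (suc t))) in *-cong e e) (toℕ i) ⟩
      V ∎
      where
      D : ℕ → Carrier
      D t = (G t - G (suc t)) * (G t - G (suc t))

    -- Adding a multiple of J to F tunes the row sums without spoiling semidefiniteness.
    module Mixture {k b l μ : Carrier} (0≤k : 0# ≤ k) (0≤l : 0# ≤ l) (0≤μ : 0# ≤ μ)
                   (kb≈n : k * b ≈ fromℕ n) (1≤n : 1 ℕ.≤ n)
                   (diag : l * S₂ + μ ≈ 1#) (row : l * (S₁ * S₁) + μ * fromℕ n ≈ b) where

      κ : Matrix n n
      κ i j = l * F i j + μ

      κ-sym : Symmetric κ
      κ-sym i j = +-congʳ (*-congˡ (F-sym i j))

      κ-nonNeg : Nonnegative κ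
      κ-nonNeg i j = +-nonNeg (*-nonNeg 0≤l (F-nonNeg i j)) 0≤μ

      κ≤1 : ∀ i j → κ i j ≤ 1#
      κ≤1 i j = ≤-respʳ-≈ diag (+-monoˡ-≤ μ (*-monoʳ-≤ 0≤l (F≤S₂ i j)))

      κ-diag : ∀ i → κ i i ≈ 1#
      κ-diag i = trans (+-congʳ (*-congˡ (F-diag i))) diag

      κ-row : ∀ i → sum (κ i) ≈ b
      κ-row i = begin
        sum (λ j → l * F i j + μ)          ≈⟨ sum-+ n _ _ ⟩
        sum (λ j → l * F i j) + sum {n} (λ _ → μ)
          ≈⟨ +-cong (trans (sum-*ˡ n l (F i)) (*-congˡ (F-row i))) (trans (sum-const n μ) (*-comm _ _)) ⟩
        l * (S₁ * S₁) + μ * fromℕ n        ≈⟨ row ⟩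
        b                                  ∎

      kκ-J-PSD : PositiveSemidefinite (k *ₛ κ ⊖ J)
      kκ-J-PSD = (λ i j → +-congʳ (*-congˡ (κ-sym i j))) , λ x →
        *-cancelˡ-nonNeg (fromℕ-nonNeg n) (1≤⇒≉0 (1≤fromℕ 1≤n)) $ ≤-respʳ-≈ (sym (form x)) $
        *-nonNeg (*-nonNeg 0≤k 0≤l) (0≤y-x (cauchy-schwarz (λ t → sum λ i → Φ t i * x i)))
        where
        module _ (x : Vector Carrier n) where
          z : Vector Carrier n
          z t = sum λ i → Φ t i * x i
          X Z : Carrier
          X = sum x
          Z = sum λ t → z t * z t
          form : fromℕ n * ⟨ x ∣ k *ₛ κ ⊖ J ∣ x ⟩ ≈ k * l * (fromℕ n * Z - sum z * sum z)
          form = begin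
            fromℕ n * ⟨ x ∣ k *ₛ κ ⊖ J ∣ x ⟩
              ≈⟨ *-congˡ (sum₂-cong n n λ i j →
                   solve 6 (λ x y k l μ f → x :* (k :* (l :* f :+ μ) :- con (+ 1)) :* y
                     := k :* l :* (x :* f :* y) :+ (k :* μ :- con (+ 1)) :* (x :* y)) refl (x i) (x j) k l μ (F i j)) ⟩
            fromℕ n * sum (λ i → sum λ j → k * l * (x i * F i j * x j) + (k * μ - 1#) * (x i * x j))
              ≈⟨ *-congˡ (trans (sum₂-+ n n _ _) (+-cong (trans (sum₂-*ˡ n n (k * l) _) (*-congˡ (F-form x)))
                   (trans (sum₂-*ˡ n n (k * μ - 1#) _) (*-congˡ (sum-*-sum n n x x))))) ⟩
            fromℕ n * (k * l * Z + (k * μ - 1#) * (X * X))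
              -- Since `z` sums to `S₁ * X`, subtracting its square leaves `X * X` with the
              -- coefficient `k` times the row sum minus `n`, which is zero. What remains is a
              -- variance of `z`.
              ≈⟨ solve 7 (λ n k l μ Z X S →
                   n :* (k :* l :* Z :+ (k :* μ :- con (+ 1)) :* (X :* X)) :=
                   k :* l :* (n :* Z :- S :* X :* (S :* X)) :+ (k :* (l :* (S :* S) :+ μ :* n) :- n) :* (X :* X))
                   refl (fromℕ n) k l μ Z X S₁ ⟩
            k * l * (fromℕ n * Z - S₁ * X * (S₁ * X)) + (k * (l * (S₁ * S₁) + μ * fromℕ n) - fromℕ n) * (X * X)
              ≈⟨ +-cong (*-congˡ (+-congˡ (-‿cong (*-cong (sym (Φ-sum x)) (sym (Φ-sum x))))))
                   (*-congʳ (trans (+-congʳ (trans (*-congˡ row) kb≈n)) (-‿inverseʳ _))) ⟩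
            k * l * (fromℕ n * Z - sum z * sum z) + 0# * (X * X)
              ≈⟨ trans (+-congˡ (zeroˡ _)) (+-identityʳ _) ⟩
            k * l * (fromℕ n * Z - sum z * sum z) ∎

      κ-distance : ∀ i j → 1# - κ i j ≈ l * (S₂ - F i j)
      κ-distance i j = trans (+-congʳ (sym diag))
        (solve 4 (λ l s μ f → l :* s :+ μ :- (l :* f :+ μ) := l :* (s :- f)) refl l S₂ μ (F i j))

-- The tent kernel.

module Tent (ℝ : CompleteOrderedField) (m′ : ℕ) (1≤m′ : 1 ℕ.≤ m′) where
  open CompleteOrderedField ℝ hiding (zero)
  open OrderedField ℝ
  open FiniteSum ℝ
  open Matrices ℝ
  open Kernels ℝ
  open SDP₂ ℝ

  -- `rest` is the length of the tail on which the tent vanishes. As `m` is a successor, `n` unfolds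
  -- to `m + m + rest`, along which sums are split.
  m rest n : ℕ
  m    = suc m′
  rest = m′ ℕ.* (m ℕ.+ m)
  n    = m ℕ.* (m ℕ.+ m)

  -- The tent with peak `m` at `m`; truncated subtraction makes it vanish from `m + m` on.
  h : ℕ → ℕ
  h t = t ℕ.⊓ (m ℕ.+ m ℕ.∸ t)

  h-up : ∀ {t} → t ℕ.≤ m → h t ≡ t
  h-up {t} t≤m = ℕ.m≤n⇒m⊓n≡m (ℕ.m+n≤o⇒m≤o∸n t (ℕ.+-mono-≤ t≤m t≤m))

  h-down : ∀ u → h (m ℕ.+ u) ≡ m ℕ.∸ u
  h-down u = ≡.trans (≡.cong ((m ℕ.+ u) ℕ.⊓_) (ℕ.[m+n]∸[m+o]≡n∸o m m u))
    (ℕ.m≥n⇒m⊓n≡n (ℕ.≤-trans (ℕ.m∸n≤m m u) (ℕ.m≤m+n m u)))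

  h-flat : ∀ u → h (m ℕ.+ m ℕ.+ u) ≡ 0
  h-flat u = ≡.trans (≡.cong ((m ℕ.+ m ℕ.+ u) ℕ.⊓_) (ℕ.m≤n⇒m∸n≡0 (ℕ.m≤m+n (m ℕ.+ m) u)))
    (ℕ.⊓-zeroʳ (m ℕ.+ m ℕ.+ u))

  G : ℕ → Carrier
  G t = fromℕ (h (t % n))

  G-periodic : ∀ t → G (t ℕ.+ n) ≈ G t
  G-periodic t = reflexive (≡.cong (fromℕ ∘ h) (ℕ.[m+n]%n≡m%n t n))

  G-shift : ∀ t {i j} → j ≡ suc i % n → G (t ℕ.+ j) ≈ G (suc t ℕ.+ i)
  G-shift t {i} {j} ≡.refl = reflexive $ ≡.cong (fromℕ ∘ h) $ begin
    (t ℕ.+ suc i % n) % n               ≡⟨ ℕ.%-distribˡ-+ t (suc i % n) n ⟩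
    (t % n ℕ.+ suc i % n % n) % n       ≡⟨ ≡.cong (λ z → (t % n ℕ.+ z) % n) (ℕ.m%n%n≡m%n (suc i) n) ⟩
    (t % n ℕ.+ suc i % n) % n           ≡⟨ ℕ.%-distribˡ-+ t (suc i) n ⟨
    (t ℕ.+ suc i) % n                   ≡⟨ ≡.cong (_% n) (ℕ.+-suc t i) ⟩
    (suc t ℕ.+ i) % n                   ∎
    where open ≡.≡-Reasoning

  G-value : ∀ {t} → t ℕ.≤ n → G t ≈ fromℕ (h t)
  G-value {t} t≤n with ℕ.m≤n⇒m<n∨m≡n t≤n
  ... | inj₁ t<n    = reflexive (≡.cong (fromℕ ∘ h) (ℕ.m<n⇒m%n≡m t<n))
  -- At `t = n` the remainder wraps to 0, and `h n` is 0 as well. The last difference in `V` uses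
  -- this endpoint.
  ... | inj₂ ≡.refl = reflexive (≡.cong fromℕ (≡.trans (≡.cong h (ℕ.n%n≡0 n)) (≡.sym (h-flat rest))))

  private
    p : Carrier
    p = fromℕ m

    ≤2m⇒≤n : ∀ {t} → t ℕ.≤ m ℕ.+ m → t ℕ.≤ n
    ≤2m⇒≤n t≤ = ℕ.≤-trans t≤ (ℕ.m≤m+n (m ℕ.+ m) rest)

  G-up : ∀ {t} → t ℕ.≤ m → G t ≈ fromℕ t
  G-up t≤m = trans (G-value (≤2m⇒≤n (ℕ.≤-trans t≤m (ℕ.m≤m+n m m)))) (reflexive (≡.cong fromℕ (h-up t≤m)))

  G-down : ∀ {u} → u ℕ.≤ m → G (m ℕ.+ u) ≈ fromℕ (m ℕ.∸ u)
  G-down {u} u≤m = trans (G-value (≤2m⇒≤n (ℕ.+-monoʳ-≤ m u≤m))) (reflexive (≡.cong fromℕ (h-down u)))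

  G-flat : ∀ {u} → u ℕ.≤ rest → G (m ℕ.+ m ℕ.+ u) ≈ 0#
  G-flat {u} u≤ = trans (G-value (ℕ.+-monoʳ-≤ (m ℕ.+ m) u≤)) (reflexive (≡.cong fromℕ (h-flat u)))

  sum-three : ∀ (g : ℕ → Carrier) → sum {n} (λ t → g (toℕ t)) ≈
    sum {m} (λ t → g (toℕ t) + g (m ℕ.+ toℕ t)) + sum {rest} (λ t → g (m ℕ.+ m ℕ.+ toℕ t))
  sum-three g = begin
    sum {n} (λ t → g (toℕ t))
      ≈⟨ sum-split (m ℕ.+ m) rest (λ t → g (toℕ t)) ⟩
    sum {m ℕ.+ m} (λ t → g (toℕ (t ↑ˡ rest))) + sum {rest} (λ t → g (toℕ ((m ℕ.+ m) ↑ʳ t)))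
      ≈⟨ +-cong (sum-cong (m ℕ.+ m) λ t → at (Fin.toℕ-↑ˡ t rest)) (sum-cong rest λ t → at (Fin.toℕ-↑ʳ (m ℕ.+ m) t)) ⟩
    sum {m ℕ.+ m} (λ t → g (toℕ t)) + sum {rest} (λ t → g (m ℕ.+ m ℕ.+ toℕ t))
      ≈⟨ +-congʳ (sum-split m m (λ t → g (toℕ t))) ⟩
    sum {m} (λ t → g (toℕ (t ↑ˡ m))) + sum {m} (λ t → g (toℕ (m ↑ʳ t))) + sum {rest} (λ t → g (m ℕ.+ m ℕ.+ toℕ t))
      ≈⟨ +-congʳ (+-cong (sum-cong m λ t → at (Fin.toℕ-↑ˡ t m)) (sum-cong m λ t → at (Fin.toℕ-↑ʳ m t))) ⟩
    sum {m} (λ t → g (toℕ t)) + sum {m} (λ t → g (m ℕ.+ toℕ t)) + sum {rest} (λ t → g (m ℕ.+ m ℕ.+ toℕ t))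
      ≈⟨ +-congʳ (sum-+ m (λ t → g (toℕ t)) (λ t → g (m ℕ.+ toℕ t))) ⟨
    sum {m} (λ t → g (toℕ t) + g (m ℕ.+ toℕ t)) + sum {rest} (λ t → g (m ℕ.+ m ℕ.+ toℕ t)) ∎
    where
    open import Relation.Binary.Reasoning.Setoid setoid
    at : ∀ {i j} → i ≡ j → g i ≈ g j
    at eq = reflexive (≡.cong g eq)

  sum-three-supported : ∀ (g : ℕ → Carrier) → (∀ u → u ℕ.< rest → g (m ℕ.+ m ℕ.+ u) ≈ 0#) →
    sum {n} (λ t → g (toℕ t)) ≈ sum {m} (λ t → g (toℕ t) + g (m ℕ.+ toℕ t))
  sum-three-supported g flat = trans (sum-three g)
    (trans (+-congˡ (trans (sum-cong rest λ t → flat (toℕ t) (Fin.toℕ<n t)) (sum-0 rest))) (+-identityʳ _))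

  open Autocorrelation n G G-periodic (λ t → fromℕ-nonNeg (h (t % n)))

  private
    ≤m : ∀ (t : Fin m) → toℕ t ℕ.≤ m
    ≤m t = ℕ.<⇒≤ (Fin.toℕ<n t)

    up+down : ∀ (t : Fin m) → G (toℕ t) + G (m ℕ.+ toℕ t) ≈ p
    up+down t = begin
      G (toℕ t) + G (m ℕ.+ toℕ t)               ≈⟨ +-cong (G-up (≤m t)) (G-down (≤m t)) ⟩
      fromℕ (toℕ t) + fromℕ (m ℕ.∸ toℕ t)       ≈⟨ fromℕ-+ (toℕ t) (m ℕ.∸ toℕ t) ⟨
      fromℕ (toℕ t ℕ.+ (m ℕ.∸ toℕ t))           ≡⟨ ≡.cong fromℕ (ℕ.m+[n∸m]≡n (≤m t)) ⟩
      p                                         ∎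
      where open import Relation.Binary.Reasoning.Setoid setoid

  S₁≈p² : S₁ ≈ p * p
  S₁≈p² = begin
    S₁                                                ≈⟨ sum-three-supported G (λ u u< → G-flat (ℕ.<⇒≤ u<)) ⟩
    sum {m} (λ t → G (toℕ t) + G (m ℕ.+ toℕ t))       ≈⟨ sum-cong m up+down ⟩
    sum {m} (λ _ → p)                                 ≈⟨ sum-const m p ⟩
    p * p                                             ∎
    where open import Relation.Binary.Reasoning.Setoid setoid

  -- Point `t` of the rising half is paired with point `m + t` of the falling half. The two values
  -- sum to `p`, and the square of a sum is at most twice the sum of the squares. This is what makes
  -- `μ` nonnegative.
  p³≤2S₂ : p * (p * p) ≤ S₂ + S₂
  p³≤2S₂ = begin
    p * (p * p)                  ≈⟨ sum-const m (p * p) ⟨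
    sum {m} (λ _ → p * p)        ≤⟨ sum-≤ m square ⟩
    sum {m} (λ t → Q t + Q t)    ≈⟨ sum-+ m Q Q ⟩
    sum {m} Q + sum {m} Q        ≈⟨ +-cong S₂≈ S₂≈ ⟨
    S₂ + S₂                      ∎
    where
    open ≤-Reasoning
    Q : Fin m → Carrier
    Q t = G (toℕ t) * G (toℕ t) + G (m ℕ.+ toℕ t) * G (m ℕ.+ toℕ t)
    S₂≈ : S₂ ≈ sum {m} Q
    S₂≈ = sum-three-supported (λ t → G t * G t) λ u u< → trans (*-congʳ (G-flat (ℕ.<⇒≤ u<))) (zeroˡ _)
    square : ∀ t → p * p ≤ Q t + Q t
    square t = begin
      p * p                                                ≈⟨ *-cong (up+down t) (up+down t) ⟨
      (G (toℕ t) + G (m ℕ.+ toℕ t)) * (G (toℕ t) + G (m ℕ.+ toℕ t))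
        ≤⟨ ≤-by (square-nonNeg (G (toℕ t) - G (m ℕ.+ toℕ t)))
             (solve 2 (λ x y → x :* x :+ y :* y :+ (x :* x :+ y :* y) :=
               (x :+ y) :* (x :+ y) :+ (x :- y) :* (x :- y)) refl (G (toℕ t)) (G (m ℕ.+ toℕ t))) ⟩
      Q t + Q t                                            ∎

  -- The tent changes by one at each of `2m` steps and is constant elsewhere.
  V≈2p : V ≈ p + p
  V≈2p = begin
    V                                               ≈⟨ sum-three-supported D flat ⟩
    sum {m} (λ t → D (toℕ t) + D (m ℕ.+ toℕ t))     ≈⟨ (sum-cong m λ t → +-cong (up t) (down t)) ⟩
    sum {m} (λ _ → 1# + 1#)                         ≈⟨ sum-const m (1# + 1#) ⟩
    p * (1# + 1#)                                   ≈⟨ solve 1 (λ p → p :* (con (+ 1) :+ con (+ 1)) := p :+ p) refl p ⟩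
    p + p                                           ∎
    where
    open import Relation.Binary.Reasoning.Setoid setoid
    D : ℕ → Carrier
    D t = (G t - G (suc t)) * (G t - G (suc t))
    D-cong : ∀ {x y u v : Carrier} → x ≈ u → y ≈ v → (x - y) * (x - y) ≈ (u - v) * (u - v)
    D-cong x≈u y≈v = *-cong (+-cong x≈u (-‿cong y≈v)) (+-cong x≈u (-‿cong y≈v))
    flat : ∀ u → u ℕ.< rest → D (m ℕ.+ m ℕ.+ u) ≈ 0#
    flat u u< = begin
      D (m ℕ.+ m ℕ.+ u)        ≈⟨ D-cong (G-flat (ℕ.<⇒≤ u<)) (trans (reflexive (≡.cong G (≡.sym (ℕ.+-suc (m ℕ.+ m) u)))) (G-flat u<)) ⟩
      (0# - 0#) * (0# - 0#)    ≈⟨ solve 0 ((con (+ 0) :- con (+ 0)) :* (con (+ 0) :- con (+ 0)) := con (+ 0)) refl ⟩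
      0#                       ∎
    up : ∀ (t : Fin m) → D (toℕ t) ≈ 1#
    up t = trans (D-cong (G-up (≤m t)) (G-up (Fin.toℕ<n t)))
      (solve 1 (λ x → (x :- (con (+ 1) :+ x)) :* (x :- (con (+ 1) :+ x)) := con (+ 1)) refl (fromℕ (toℕ t)))
    down : ∀ (t : Fin m) → D (m ℕ.+ toℕ t) ≈ 1#
    down t = trans (D-cong
        (trans (G-down (≤m t)) (reflexive (≡.cong fromℕ (ℕ.+-∸-assoc 1 (Fin.toℕ≤pred[n] t)))))
        (trans (reflexive (≡.cong G (≡.sym (ℕ.+-suc m (toℕ t))))) (G-down (Fin.toℕ<n t))))
      (solve 1 (λ x → (con (+ 1) :+ x :- x) :* (con (+ 1) :+ x :- x) := con (+ 1)) refl (fromℕ (m′ ℕ.∸ toℕ t)))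

  private
    n≈ : fromℕ n ≈ p * (p + p)
    n≈ = trans (fromℕ-* m (m ℕ.+ m)) (*-congˡ (fromℕ-+ m m))

    0≤p : 0# ≤ p
    0≤p = fromℕ-nonNeg m

    1≤p : 1# ≤ p
    1≤p = 1≤fromℕ {m} (s≤s z≤n)

    1≤p-1 : 1# ≤ p - 1#
    1≤p-1 = ≤-respʳ-≈ (solve 1 (λ x → x := con (+ 1) :+ x :- con (+ 1)) refl (fromℕ m′)) (1≤fromℕ 1≤m′)

    Δ : Carrier
    Δ = fromℕ n * S₂ - S₁ * S₁

    -- n S₂ = p² (2 S₂) ≥ p² p³ and S₁² = p⁴.
    1≤Δ : 1# ≤ Δ
    1≤Δ = begin
      1#                                             ≤⟨ 1≤* (1≤* (1≤* 1≤p 1≤p) (1≤* 1≤p 1≤p)) 1≤p-1 ⟩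
      p * p * (p * p) * (p - 1#)                     ≤⟨ ≤-by (*-nonNeg (*-nonNeg 0≤p 0≤p) (0≤y-x p³≤2S₂))
        (solve 2 (λ p s → p :* (p :+ p) :* s :- p :* p :* (p :* p) :=
           p :* p :* (p :* p) :* (p :- con (+ 1)) :+ p :* p :* (s :+ s :- p :* (p :* p))) refl p S₂) ⟩
      p * (p + p) * S₂ - p * p * (p * p)             ≈⟨ +-cong (*-congʳ n≈) (-‿cong (*-cong S₁≈p² S₁≈p²)) ⟨
      Δ                                              ∎
      where open ≤-Reasoning

    0≤Δ : 0# ≤ Δ
    0≤Δ = ≤-trans 0≤1 1≤Δ

    0≤Δ⁻¹ : 0# ≤ Δ ⁻¹
    0≤Δ⁻¹ = ⁻¹-nonNeg 0≤Δ (1≤⇒≉0 1≤Δ)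

    Δ⁻¹-inverse : Δ * Δ ⁻¹ ≈ 1#
    Δ⁻¹-inverse = ⁻¹-inverseʳ Δ (1≤⇒≉0 1≤Δ)

    -- Cramer's rule for the equations `diag` and `row` in the unknowns `l` and `μ`, with
    -- determinant `Δ`.
    b l μ : Carrier
    b = p + p
    l = (fromℕ n - b) / Δ
    μ = (b * S₂ - S₁ * S₁) / Δ

    0≤l : 0# ≤ l
    0≤l = *-nonNeg (≤-respʳ-≈ eq (*-nonNeg (+-nonNeg 0≤p 0≤p) (≤-trans 0≤1 1≤p-1))) 0≤Δ⁻¹
      where
      eq : (p + p) * (p - 1#) ≈ fromℕ n - b
      eq = trans (solve 1 (λ p → (p :+ p) :* (p :- con (+ 1)) := p :* (p :+ p) :- (p :+ p)) refl p) (+-congʳ (sym n≈))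

    0≤μ : 0# ≤ μ
    0≤μ = *-nonNeg (≤-respʳ-≈ eq (*-nonNeg 0≤p (0≤y-x p³≤2S₂))) 0≤Δ⁻¹
      where
      eq : p * (S₂ + S₂ - p * (p * p)) ≈ b * S₂ - S₁ * S₁
      eq = trans (solve 2 (λ p s → p :* (s :+ s :- p :* (p :* p)) := (p :+ p) :* s :- p :* p :* (p :* p)) refl p S₂)
        (+-congˡ (-‿cong (sym (*-cong S₁≈p² S₁≈p²))))

    diag : l * S₂ + μ ≈ 1#
    diag = trans (solve 5 (λ n b s t w → (n :- b) :* w :* s :+ (b :* s :- t) :* w := (n :* s :- t) :* w)
      refl (fromℕ n) b S₂ (S₁ * S₁) (Δ ⁻¹)) Δ⁻¹-inverse

    row : l * (S₁ * S₁) + μ * fromℕ n ≈ b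
    row = trans (solve 5 (λ n b s t w → (n :- b) :* w :* t :+ (b :* s :- t) :* w :* n := b :* ((n :* s :- t) :* w))
      refl (fromℕ n) b S₂ (S₁ * S₁) (Δ ⁻¹)) (trans (*-congˡ Δ⁻¹-inverse) (*-identityʳ b))

    open Mixture 0≤p 0≤l 0≤μ (sym n≈) (s≤s z≤n) diag row

    -- n (1 - κ) = 2p²·l·V/2 = 2lp³ ≤ 4lS₂ ≤ 4.
    step : ∀ i j → toℕ j ≡ suc (toℕ i) % n → fromℕ n * (1# - κ i j) ≤ 4#
    step i j j≡ = begin
      fromℕ n * (1# - κ i j)              ≈⟨ *-cong n≈ (κ-distance i j) ⟩
      p * (p + p) * (l * (S₂ - F i j))    ≤⟨ *-monoʳ-≤ (*-nonNeg 0≤p (+-nonNeg 0≤p 0≤p)) (*-monoʳ-≤ 0≤l S₂-F≤p) ⟩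
      p * (p + p) * (l * p)               ≤⟨ ≤-by (*-nonNeg (+-nonNeg 0≤l 0≤l) (0≤y-x p³≤2S₂))
        (solve 3 (λ p l s → l :* s :+ l :* s :+ l :* s :+ l :* s := p :* (p :+ p) :* (l :* p) :+ (l :+ l) :* (s :+ s :- p :* (p :* p))) refl p l S₂) ⟩
      l * S₂ + l * S₂ + l * S₂ + l * S₂   ≤⟨ +-mono-≤ (+-mono-≤ (+-mono-≤ lS₂≤1 lS₂≤1) lS₂≤1) lS₂≤1 ⟩
      4#                                  ∎
      where
      open ≤-Reasoning
      lS₂≤1 : l * S₂ ≤ 1#
      lS₂≤1 = ≤-by 0≤μ (sym diag)
      S₂-F≤p : S₂ - F i j ≤ p
      S₂-F≤p = x≤y $ 0≤x+x⇒0≤x $ ≤-reflexive $ sym $ trans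
        (solve 2 (λ p d → p :- d :+ (p :- d) := p :+ p :- (d :+ d)) refl p (S₂ - F i j))
        (trans (+-congˡ (-‿cong (trans (distance-step i j λ t → G-shift t j≡) V≈2p))) (-‿inverseʳ _))

  kernel : Kernel m (m ℕ.+ m)
  kernel = record
    { κ = κ ; κ-sym = κ-sym ; κ-nonNeg = κ-nonNeg ; κ≤1 = κ≤1 ; κ-diag = κ-diag
    ; κ-row = λ i → trans (κ-row i) (sym (fromℕ-+ m m))
    ; kκ-J-PSD = kκ-J-PSD ; κ-step = step }

-- Adjacency in the cycle after deleting a position.

toℕ-next : ∀ {n} (i : Fin (suc n)) → toℕ (next i) ≡ suc (toℕ i) % suc n
toℕ-next i = Fin.toℕ-fromℕ< _

toℕ-punchIn : ∀ {n} (r : Fin (suc n)) (i : Fin n) →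
  (toℕ i ℕ.< toℕ r × toℕ (punchIn r i) ≡ toℕ i) ⊎ (toℕ r ℕ.≤ toℕ i × toℕ (punchIn r i) ≡ suc (toℕ i))
toℕ-punchIn zero    i       = inj₂ (z≤n , ≡.refl)
toℕ-punchIn (suc r) zero    = inj₁ (s≤s z≤n , ≡.refl)
toℕ-punchIn (suc r) (suc i) with toℕ-punchIn r i
... | inj₁ (i<r , eq) = inj₁ (s≤s i<r , ≡.cong suc eq)
... | inj₂ (r≤i , eq) = inj₂ (s≤s r≤i , ≡.cong suc eq)

-- Deleting `r` leaves a path whose edges, after relabelling, join cyclic neighbours modulo `n`. The
-- wraparound occurs when `r` is neither the first nor the last position, so a cyclic kernel serves
-- every `r`.
punchIn-next : ∀ {n} .{{_ : NonZero n}} (r : Fin (suc n)) (i j : Fin n) →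
               punchIn r j ≡ next (punchIn r i) → toℕ j ≡ suc (toℕ i) % n
punchIn-next {n} r i j eq = main (toℕ-punchIn r i) (toℕ-punchIn r j)
  where
  a = toℕ i
  c = toℕ j
  ρ = toℕ r
  next≡ : ∀ {x} → toℕ (punchIn r i) ≡ x → toℕ (punchIn r j) ≡ suc x % suc n
  next≡ ≡.refl = ≡.trans (≡.cong toℕ eq) (toℕ-next (punchIn r i))
  unwrap : ∀ {x} → c ≡ suc x → c ≡ suc x % n
  unwrap e = ≡.trans e (≡.sym (ℕ.m<n⇒m%n≡m (≡.subst (ℕ._< n) e (Fin.toℕ<n j))))
  main : (a ℕ.< ρ × toℕ (punchIn r i) ≡ a) ⊎ (ρ ℕ.≤ a × toℕ (punchIn r i) ≡ suc a) →
         (c ℕ.< ρ × toℕ (punchIn r j) ≡ c) ⊎ (ρ ℕ.≤ c × toℕ (punchIn r j) ≡ suc c) →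
         c ≡ suc a % n
  main (inj₁ (a<ρ , pi≡)) pj = step pj
    where
    pj≡ : toℕ (punchIn r j) ≡ suc a
    pj≡ = ≡.trans (next≡ pi≡) (ℕ.m<n⇒m%n≡m (s≤s (Fin.toℕ<n i)))
    step : _ → c ≡ suc a % n
    step (inj₁ (_ , pj≡c))     = unwrap (≡.trans (≡.sym pj≡c) pj≡)
    step (inj₂ (ρ≤c , pj≡sc)) = ⊥-elim $ ℕ.<⇒≱ a<ρ $
      ≡.subst (ρ ℕ.≤_) (ℕ.suc-injective (≡.trans (≡.sym pj≡sc) pj≡)) ρ≤c
  main (inj₂ (ρ≤a , pi≡)) pj with ℕ.m≤n⇒m<n∨m≡n (Fin.toℕ<n i)
  ... | inj₁ sa<n = step pj
    where
    pj≡ : toℕ (punchIn r j) ≡ suc (suc a)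
    pj≡ = ≡.trans (next≡ pi≡) (ℕ.m<n⇒m%n≡m (s≤s sa<n))
    step : _ → c ≡ suc a % n
    step (inj₁ (c<ρ , pj≡c))  = ⊥-elim $ ℕ.<⇒≱ c<ρ $ ℕ.≤-trans ρ≤a $
      ≡.subst (a ℕ.≤_) (≡.trans (≡.sym pj≡) pj≡c) (ℕ.m≤n⇒m≤1+n (ℕ.n≤1+n a))
    step (inj₂ (_ , pj≡sc))   = unwrap (ℕ.suc-injective (≡.trans (≡.sym pj≡sc) pj≡))
  ... | inj₂ sa≡n = step pj
    where
    pj≡ : toℕ (punchIn r j) ≡ 0
    pj≡ = ≡.trans (next≡ pi≡) (≡.trans (≡.cong (λ z → suc z % suc n) sa≡n) (ℕ.n%n≡0 (suc n)))
    step : _ → c ≡ suc a % n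
    step (inj₁ (_ , pj≡c)) = ≡.trans (≡.trans (≡.sym pj≡c) pj≡)
      (≡.sym (≡.trans (≡.cong (_% n) sa≡n) (ℕ.n%n≡0 n)))
    step (inj₂ (_ , pj≡sc)) with () ← ≡.trans (≡.sym pj≡) pj≡sc

module CycleAdjacency (ℝ : CompleteOrderedField) where
  open CompleteOrderedField ℝ hiding (zero)
  open OrderedField ℝ
  open FiniteSum ℝ
  open Kernels ℝ
  open SDP₂ ℝ renaming (cycleAdjacency to C)

  sum-next : ∀ n (f : Vector Carrier (suc n)) → sum (λ i → f (next i)) ≈ sum f
  sum-next n f = begin
    sum (λ i → f (next i))                                ≈⟨ (sum-cong (suc n) λ i → at (ℕ.+-comm 1 (toℕ i))) ⟩
    sum {suc n} (λ i → f ((toℕ i ℕ.+ 1) mod suc n))       ≈⟨ sum-shift (suc n) (λ t → f (t mod suc n)) periodic 1 ⟩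
    sum {suc n} (λ i → f (toℕ i mod suc n))               ≈⟨ (sum-cong (suc n) λ i → reflexive (≡.cong f (mod-toℕ i))) ⟩
    sum f                                                 ∎
    where
    open import Relation.Binary.Reasoning.Setoid setoid
    at : ∀ {s t} → s ≡ t → f (s mod suc n) ≈ f (t mod suc n)
    at eq = reflexive (≡.cong (λ t → f (t mod suc n)) eq)
    mod-toℕ : ∀ (i : Fin (suc n)) → toℕ i mod suc n ≡ i
    mod-toℕ i = Fin.toℕ-injective (≡.trans (Fin.toℕ-fromℕ< _) (ℕ.m<n⇒m%n≡m (Fin.toℕ<n i)))
    periodic : ∀ t → f ((t ℕ.+ suc n) mod suc n) ≈ f (t mod suc n)
    periodic t = reflexive (≡.cong f (Fin.toℕ-injective
      (≡.trans (Fin.toℕ-fromℕ< _) (≡.trans (ℕ.[m+n]%n≡m%n t (suc n)) (≡.sym (Fin.toℕ-fromℕ< _))))))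

  C-sym : ∀ {n} → Symmetric (C {n})
  C-sym x y with y ≟ᶠ next x | x ≟ᶠ next y
  ... | yes _ | yes _ = refl
  ... | yes _ | no _  = refl
  ... | no _  | yes _ = refl
  ... | no _  | no _  = refl

  C-nonNeg : ∀ {n} → Nonnegative (C {n})
  C-nonNeg x y with y ≟ᶠ next x | x ≟ᶠ next y
  ... | yes _ | yes _ = 0≤1
  ... | yes _ | no _  = 0≤1
  ... | no _  | yes _ = 0≤1
  ... | no _  | no _  = ≤-refl

  -- Only an inequality, because the two neighbours coincide in cycles of length one or two.
  C≤ : ∀ {n} (x y : Fin (suc n)) → C x y ≤ I (next x) y + I x (next y)
  C≤ x y = ≤-trans bound (+-mono-≤ (≤-reflexive (I-sym y (next x))) ≤-refl)
    where
    bound : C x y ≤ I y (next x) + I x (next y)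
    bound with y ≟ᶠ next x | x ≟ᶠ next y
    ... | yes _ | yes _ = ≤-by 0≤1 refl
    ... | yes _ | no _  = ≤-reflexive (sym (+-identityʳ 1#))
    ... | no _  | yes _ = ≤-reflexive (sym (+-identityˡ 1#))
    ... | no _  | no _  = ≤-reflexive (sym (+-identityˡ 0#))

  sum-I-row : ∀ {n} (x : Fin n) → sum (I x) ≈ 1#
  sum-I-row {n} x = trans (sum-cong n λ y → sym (*-identityʳ (I x y))) (sum-I x (λ _ → 1#))

  C-row : ∀ {n} (x : Fin (suc n)) → sum (C x) ≤ 1# + 1#
  C-row {n} x = begin
    sum (C x)                                          ≤⟨ sum-≤ (suc n) (C≤ x) ⟩
    sum (λ y → I (next x) y + I x (next y))            ≈⟨ sum-+ (suc n) (I (next x)) (λ y → I x (next y)) ⟩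
    sum (I (next x)) + sum (λ y → I x (next y))        ≈⟨ +-cong (sum-I-row (next x)) (trans (sum-next n (I x)) (sum-I-row x)) ⟩
    1# + 1#                                            ∎
    where open ≤-Reasoning

  C-punchIn-row : ∀ {n} (r x : Fin (suc n)) → sum (λ i → C x (punchIn r i)) ≤ 1# + 1#
  C-punchIn-row r x = ≤-trans (≤-by (C-nonNeg x r) (trans (sum-remove {i = r} (C x)) (+-comm _ _))) (C-row x)

  module _ {k b : ℕ} .{{_ : NonZero (k ℕ.* b)}} (K : Kernel k b) where
    open Kernel K
    private
      n = k ℕ.* b

    -- The adjacency entry as a factor turns the conditional bound `κ-step` into one for all pairs,
    -- ready to be summed.
    κ-adjacent : ∀ r (i j : Fin n) →
      C (punchIn r i) (punchIn r j) * (fromℕ n * (1# - κ i j)) ≤ C (punchIn r i) (punchIn r j) * 4#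
    κ-adjacent r i j with punchIn r j ≟ᶠ next (punchIn r i) | punchIn r i ≟ᶠ next (punchIn r j)
    ... | yes eq | yes _ = *-monoʳ-≤ 0≤1 (κ-step i j (punchIn-next r i j eq))
    ... | yes eq | no _  = *-monoʳ-≤ 0≤1 (κ-step i j (punchIn-next r i j eq))
    ... | no _  | yes eq = *-monoʳ-≤ 0≤1 (≤-respˡ-≈ (*-congˡ (+-congˡ (-‿cong (κ-sym j i))))
                             (κ-step j i (punchIn-next r j i eq)))
    ... | no _  | no _  = ≤-reflexive (trans (zeroˡ _) (sym (zeroˡ _)))

-- The feasible matrix built from a kernel.

module GroupedSolution (ℝ : CompleteOrderedField) {k b : ℕ} .{{_ : NonZero (k ℕ.* b)}}
                       (2≤k : 2 ℕ.≤ k) (2≤b : 2 ℕ.≤ b) (K : Kernels.Kernel ℝ k b) where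
  open CompleteOrderedField ℝ hiding (zero)
  open OrderedField ℝ
  open FiniteSum ℝ
  open Matrices ℝ
  open Kernels ℝ
  open CycleAdjacency ℝ
  open SDP₂ ℝ
  open Kernel K

  n : ℕ
  n = k ℕ.* b

  group : Fin n → Fin k
  group v = proj₁ (remQuot b v)

  γ : Matrix n n
  γ u v = I (group u) (group v)

  -- The probabilities behind `Y` with denominators cleared: `w * c₁` is `1/n`, `w * c₂` is
  -- `1/(n(b-1))` and `w * c₃` is `1/(n(n-b))`. They belong to one vertex, to two vertices of a
  -- group, and to vertices of different groups.
  k̂ b̂ ν c₁ c₂ c₃ w : Carrier
  k̂ = fromℕ k
  b̂ = fromℕ b
  ν = fromℕ n
  c₁ = b̂ * (b̂ - 1#) * (k̂ - 1#)
  c₂ = b̂ * (k̂ - 1#)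
  c₃ = b̂ - 1#
  w = (ν * c₁) ⁻¹

  private
    𝟙 : ∀ {m} → Polynomial m
    𝟙 = con (+ 1)

    ν≈kb : ν ≈ k̂ * b̂
    ν≈kb = fromℕ-* k b

    1≤pred : ∀ {m} → 2 ℕ.≤ m → 1# ≤ fromℕ m - 1#
    1≤pred {suc m} (s≤s 1≤m) = ≤-respʳ-≈ (solve 1 (λ x → x := 𝟙 :+ x :- 𝟙) refl (fromℕ m)) (1≤fromℕ 1≤m)

    1≤k : 1# ≤ k̂
    1≤k = 1≤fromℕ {k} (ℕ.≤-trans (s≤s z≤n) 2≤k)

    1≤b : 1# ≤ b̂
    1≤b = 1≤fromℕ {b} (ℕ.≤-trans (s≤s z≤n) 2≤b)

    1≤ν : 1# ≤ ν
    1≤ν = ≤-respʳ-≈ (sym ν≈kb) (1≤* 1≤k 1≤b)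

    nonNeg : ∀ {x} → 1# ≤ x → 0# ≤ x
    nonNeg = ≤-trans 0≤1

    1≤c₁ : 1# ≤ c₁
    1≤c₁ = 1≤* (1≤* 1≤b (1≤pred 2≤b)) (1≤pred 2≤k)

    1≤c₂ : 1# ≤ c₂
    1≤c₂ = 1≤* 1≤b (1≤pred 2≤k)

    1≤νc₁ : 1# ≤ ν * c₁
    1≤νc₁ = 1≤* 1≤ν 1≤c₁

    0≤w : 0# ≤ w
    0≤w = ⁻¹-nonNeg (nonNeg 1≤νc₁) (1≤⇒≉0 1≤νc₁)

  νc₁w≈1 : ν * c₁ * w ≈ 1#
  νc₁w≈1 = ⁻¹-inverseʳ _ (1≤⇒≉0 1≤νc₁)

  sum-group : ∀ (f : Fin k → Carrier) → sum (λ v → f (group v)) ≈ b̂ * sum f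
  sum-group f = trans (sum-remQuot k b (λ g _ → f g))
    (trans (sum-cong k λ g → sum-const b (f g)) (sum-*ˡ k b̂ f))

  γ-row : ∀ u → sum (γ u) ≈ b̂
  γ-row u = trans (sum-group (I (group u))) (trans (*-congˡ (sum-I-row (group u))) (*-identityʳ b̂))

  γ-sym : Symmetric γ
  γ-sym u v = I-sym (group u) (group v)

  γ-diag : ∀ u → γ u u ≈ 1#
  γ-diag u = I-refl (group u)

  γ-column : ∀ v → sum (λ u → γ u v) ≈ b̂
  γ-column v = trans (sum-cong n λ u → γ-sym u v) (γ-row v)

  γ²≈bγ : ∀ u v → (γ · γ) u v ≈ b̂ * γ u v
  γ²≈bγ u v = trans (sum-group λ g → I (group u) g * I g (group v))
    (*-congˡ (sum-I (group u) λ g → I g (group v)))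

  -- The entry for `(u , i)` and `(v , j)` imitates the probability that `u` sits at `i` and `v` at
  -- `j`. Given `u` at `i`, another position `j` holds a vertex of the same group with probability
  -- `κ i j`, each of the other `b - 1` members being equally likely; otherwise each of the `n - b`
  -- outsiders is.
  Y : Matrix (n ℕ.* n) (n ℕ.* n)
  Y = w *ₛ (c₁ *ₛ (I {n} ⊗ I {n}) ⊕ c₂ *ₛ ((γ ⊖ I) ⊗ (κ ⊖ I)) ⊕ c₃ *ₛ ((J ⊖ γ) ⊗ (J ⊖ κ)))

  private
    I≤ : ∀ {m} {M : Matrix m m} → Nonnegative M → (∀ i → M i i ≈ 1#) → ∀ i j → I i j ≤ M i j
    I≤ 0≤M diag i j with i ≟ᶠ j
    ... | yes ≡.refl = ≤-reflexive (sym (diag i))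
    ... | no _       = 0≤M i j

    I≤1 : ∀ {m} (i j : Fin m) → I i j ≤ 1#
    I≤1 i j with i ≟ᶠ j
    ... | yes _ = ≤-refl
    ... | no _  = 0≤1

  Y-nonNeg : Nonnegative Y
  Y-nonNeg p q = *-nonNeg 0≤w (+-nonNeg (+-nonNeg
    (*-nonNeg (nonNeg 1≤c₁) (⊗-nonNeg {A = I {n}} {I {n}} I-nonNeg I-nonNeg p q))
    (*-nonNeg (nonNeg 1≤c₂) (⊗-nonNeg {A = γ ⊖ I} {κ ⊖ I}
      (λ u v → 0≤y-x (I≤ (λ u v → I-nonNeg (group u) (group v)) γ-diag u v))
      (λ i j → 0≤y-x (I≤ κ-nonNeg κ-diag i j)) p q)))
    (*-nonNeg (nonNeg (1≤pred 2≤b)) (⊗-nonNeg {A = J ⊖ γ} {J ⊖ κ}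
      (λ u v → 0≤y-x (I≤1 (group u) (group v))) (λ i j → 0≤y-x (κ≤1 i j)) p q)))

  private
    bI-γ kγ-J bI-κ kκ-J : Matrix n n
    bI-γ = b̂ *ₛ I ⊖ γ
    kγ-J = k̂ *ₛ γ ⊖ J
    bI-κ = b̂ *ₛ I ⊖ κ
    kκ-J = k̂ *ₛ κ ⊖ J

    -- `bI-γ` is `b` times the projection onto the vectors that sum to zero on each group. Likewise
    -- `kγ-J` is `n` times the projection onto the vectors constant on groups with total zero.
    bI-γ-projection : ∀ u v → (bI-γ · bI-γ) u v ≈ b̂ * bI-γ u v
    bI-γ-projection u v = begin
      sum (λ t → (b̂ * I u t - γ u t) * (b̂ * I t v - γ t v))
        ≈⟨ (sum-cong n λ t → solve 5 (λ b x y z w → (b :* x :- y) :* (b :* z :- w) :=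
             x :* (b :* (b :* z :- w)) :+ (y :* w :- b :* (z :* y))) refl b̂ (I u t) (γ u t) (I t v) (γ t v)) ⟩
      sum (λ t → I u t * (b̂ * (b̂ * I t v - γ t v)) + (γ u t * γ t v - b̂ * (I t v * γ u t)))
        ≈⟨ trans (sum-+ n _ _) (+-cong (sum-I u λ t → b̂ * (b̂ * I t v - γ t v))
             (trans (sum-- n _ _) (+-cong (γ²≈bγ u v) (-‿cong (trans (sum-*ˡ n b̂ _)
               (*-congˡ (trans (sum-cong n λ t → *-congʳ (I-sym t v)) (sum-I v (γ u))))))))) ⟩
      b̂ * (b̂ * I u v - γ u v) + (b̂ * γ u v - b̂ * γ u v)
        ≈⟨ solve 3 (λ b i g → b :* (b :* i :- g) :+ (b :* g :- b :* g) := b :* (b :* i :- g)) refl b̂ (I u v) (γ u v) ⟩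
      b̂ * (b̂ * I u v - γ u v) ∎
      where open import Relation.Binary.Reasoning.Setoid setoid

    kγ-J-projection : ∀ u v → (kγ-J · kγ-J) u v ≈ ν * kγ-J u v
    kγ-J-projection u v = begin
      sum (λ t → (k̂ * γ u t - 1#) * (k̂ * γ t v - 1#))
        ≈⟨ (sum-cong n λ t → solve 3 (λ k x y → (k :* x :- 𝟙) :* (k :* y :- 𝟙) :=
             k :* k :* (x :* y) :- k :* x :- (k :* y :- 𝟙)) refl k̂ (γ u t) (γ t v)) ⟩
      sum (λ t → k̂ * k̂ * (γ u t * γ t v) - k̂ * γ u t - (k̂ * γ t v - 1#))
        ≈⟨ trans (sum-- n _ _) (+-cong
             (trans (sum-- n _ _) (+-cong (trans (sum-*ˡ n (k̂ * k̂) _) (*-congˡ (γ²≈bγ u v)))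
                                          (-‿cong (trans (sum-*ˡ n k̂ _) (*-congˡ (γ-row u))))))
             (-‿cong (trans (sum-- n _ _) (+-cong (trans (sum-*ˡ n k̂ _) (*-congˡ (γ-column v))) (-‿cong (sum-1 n)))))) ⟩
      k̂ * k̂ * (b̂ * γ u v) - k̂ * b̂ - (k̂ * b̂ - ν)
        ≈⟨ +-congˡ (-‿cong (+-congˡ (-‿cong ν≈kb))) ⟩
      k̂ * k̂ * (b̂ * γ u v) - k̂ * b̂ - (k̂ * b̂ - k̂ * b̂)
        ≈⟨ solve 3 (λ k b g → k :* k :* (b :* g) :- k :* b :- (k :* b :- k :* b) := k :* b :* (k :* g :- 𝟙)) refl k̂ b̂ (γ u v) ⟩
      k̂ * b̂ * (k̂ * γ u v - 1#)
        ≈⟨ *-congʳ ν≈kb ⟨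
      ν * (k̂ * γ u v - 1#) ∎
      where open import Relation.Binary.Reasoning.Setoid setoid

    J-PSD : PositiveSemidefinite (J {n})
    J-PSD = (λ _ _ → refl) , λ x → ≤-respʳ-≈
      (sym (trans (sum₂-cong n n λ i j → *-congʳ (*-identityʳ (x i))) (sum-*-sum n n x x)))
      (square-nonNeg (sum x))

    J-projection : ∀ u v → (J {n} · J {n}) u v ≈ ν * J {n} u v
    J-projection u v = trans (sum-cong n λ _ → *-identityʳ 1#) (trans (sum-1 n) (sym (*-identityʳ ν)))

  -- k times the bracket in Y is a combination of Kronecker products of semidefinite
  -- matrices: the isotypic decomposition of Y under permutations within and of the groups.
  Y-PSD : PositiveSemidefinite Y
  Y-PSD = PSD-cong equal $ PSD-*ₛ {c = w * k̂ ⁻¹} (*-nonNeg 0≤w (⁻¹-nonNeg (nonNeg 1≤k) (1≤⇒≉0 1≤k))) $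
    PSD-⊕ (PSD-⊕
      (PSD-*ₛ (*-nonNeg (nonNeg 1≤k) (nonNeg (1≤pred 2≤k)))
        (PSD-projection-⊗ {A = bI-γ} {B = bI-κ} (nonNeg 1≤b) (1≤⇒≉0 1≤b)
          (λ u v → +-cong (*-congˡ (I-sym u v)) (-‿cong (γ-sym u v))) bI-γ-projection
          (Laplacian-PSD κ-sym κ-nonNeg κ-row)))
      (PSD-*ₛ (nonNeg (1≤pred 2≤b))
        (PSD-projection-⊗ {A = kγ-J} {B = kκ-J} (nonNeg 1≤ν) (1≤⇒≉0 1≤ν)
          (λ u v → +-congʳ (*-congˡ (γ-sym u v))) kγ-J-projection kκ-J-PSD)))
      (PSD-*ₛ (*-nonNeg (nonNeg (1≤pred 2≤b)) (nonNeg (1≤pred 2≤k)))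
        (PSD-projection-⊗ {A = J {n}} {B = J {n}} (nonNeg 1≤ν) (1≤⇒≉0 1≤ν) (λ _ _ → refl) J-projection J-PSD))
    where
    identity : ∀ u v g x →
      k̂ * (k̂ - 1#) * ((b̂ * u - g) * (b̂ * v - x)) + (b̂ - 1#) * ((k̂ * g - 1#) * (k̂ * x - 1#)) + (b̂ - 1#) * (k̂ - 1#) * (1# * 1#) ≈
      k̂ * (c₁ * (u * v) + c₂ * ((g - u) * (x - v)) + c₃ * ((1# - g) * (1# - x)))
    identity u v g x = solve 6 (λ u v g x b k →
      k :* (k :- 𝟙) :* ((b :* u :- g) :* (b :* v :- x)) 
        :+ (b :- 𝟙) :* ((k :* g :- 𝟙) :* (k :* x :- 𝟙)) :+ (b :- 𝟙) :* (k :- 𝟙) :* (𝟙 :* 𝟙) :=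
      k :* (b :* (b :- 𝟙) :* (k :- 𝟙) :* (u :* v) :+ b :* (k :- 𝟙) :* ((g :- u) :* (x :- v)) :+ (b :- 𝟙) :* ((𝟙 :- g) :* (𝟙 :- x))))
      refl u v g x b̂ k̂
    equal : ∀ p q → (w * k̂ ⁻¹) * _ ≈ Y p q
    equal p q = trans (*-congˡ (identity _ _ _ _)) (trans
      (solve 4 (λ w l k y → w :* l :* (k :* y) := k :* l :* (w :* y)) refl w (k̂ ⁻¹) k̂ _)
      (trans (*-congʳ (⁻¹-inverseʳ k̂ (1≤⇒≉0 1≤k))) (*-identityˡ _)))

  trace-⊗-Y : ∀ (M N : Matrix n n) {a₁ a₂ a₃ b₁ b₂ b₃} →
    trace (M · I) ≈ a₁ → trace (M · (γ ⊖ I)) ≈ a₂ → trace (M · (J ⊖ γ)) ≈ a₃ →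
    trace (N · I) ≈ b₁ → trace (N · (κ ⊖ I)) ≈ b₂ → trace (N · (J ⊖ κ)) ≈ b₃ →
    trace ((M ⊗ N) · Y) ≈ w * (c₁ * (a₁ * b₁) + c₂ * (a₂ * b₂) + c₃ * (a₃ * b₃))
  trace-⊗-Y M N a₁ a₂ a₃ b₁ b₂ b₃ =
    trans (trace-*ₛʳ w (Y₁ ⊕ Y₂ ⊕ Y₃) MN) $ *-congˡ $ trans (trace-⊕ʳ (Y₁ ⊕ Y₂) Y₃ MN) $ +-cong
      (trans (trace-⊕ʳ Y₁ Y₂ MN) (+-cong
        (trans (trace-*ₛʳ c₁ (I {n} ⊗ I {n}) MN) (*-congˡ (trans (trace-⊗ M I N I) (*-cong a₁ b₁))))
        (trans (trace-*ₛʳ c₂ ((γ ⊖ I) ⊗ (κ ⊖ I)) MN) (*-congˡ (trans (trace-⊗ M (γ ⊖ I) N (κ ⊖ I)) (*-cong a₂ b₂))))))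
      (trans (trace-*ₛʳ c₃ ((J ⊖ γ) ⊗ (J ⊖ κ)) MN) (*-congˡ (trans (trace-⊗ M (J ⊖ γ) N (J ⊖ κ)) (*-cong a₃ b₃))))
    where
    MN Y₁ Y₂ Y₃ : Matrix (n ℕ.* n) (n ℕ.* n)
    MN = M ⊗ N
    Y₁ = c₁ *ₛ (I {n} ⊗ I {n})
    Y₂ = c₂ *ₛ ((γ ⊖ I) ⊗ (κ ⊖ I))
    Y₃ = c₃ *ₛ ((J ⊖ γ) ⊗ (J ⊖ κ))

  private
    trace-I-zero : ∀ {M : Matrix n n} → (∀ i → M i i ≈ 0#) → trace (I · M) ≈ 0#
    trace-I-zero {M} zero-diag = trans (trace-I M) (trans (sum-cong n zero-diag) (sum-0 n))

    diff-diag : ∀ {x y} → x ≈ 1# → y ≈ 1# → x - y ≈ 0#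
    diff-diag x≈1 y≈1 = trans (+-cong x≈1 (-‿cong y≈1)) (-‿inverseʳ 1#)

    I-γ : trace (I · (γ ⊖ I)) ≈ 0#
    I-γ = trace-I-zero λ i → diff-diag (γ-diag i) (I-refl i)
    I-κ : trace (I · (κ ⊖ I)) ≈ 0#
    I-κ = trace-I-zero λ i → diff-diag (κ-diag i) (I-refl i)
    J-γ : trace (I · (J ⊖ γ)) ≈ 0#
    J-γ = trace-I-zero λ i → diff-diag refl (γ-diag i)
    J-κ : trace (I · (J ⊖ κ)) ≈ 0#
    J-κ = trace-I-zero λ i → diff-diag refl (κ-diag i)

    I-I : trace (I {n} · I) ≈ ν
    I-I = trans (trace-I (I {n})) (trans (sum-cong n I-refl) (sum-1 n))

    off-diagonal-I : trace ((J {n} ⊖ I) · I) ≈ 0#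
    off-diagonal-I = trans (trace-comm (J {n} ⊖ I) I) (trace-I-zero {J ⊖ I} λ i → diff-diag refl (I-refl i))

    J-trace : ∀ {M : Matrix n n} {ρ} → (∀ i → sum (M i) ≈ ρ) → trace (J · M) ≈ ν * ρ
    J-trace {M} {ρ} row = trans (trace-comm J M) (trans
      (sum-cong n λ i → trans (sum-cong n λ j → *-identityʳ (M i j)) (row i)) (sum-const n ρ))

    minus-row : ∀ {A B : Matrix n n} {x y} → (∀ i → sum (A i) ≈ x) → (∀ i → sum (B i) ≈ y) → ∀ i → sum ((A ⊖ B) i) ≈ x - y
    minus-row {A} {B} rowA rowB i = trans (sum-- n (A i) (B i)) (+-cong (rowA i) (-‿cong (rowB i)))

  Y-feasible : Feasible {n} Y
  Y-feasible = record
    { nonnegative          = Y-nonNeg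
    ; positiveSemidefinite = Y-PSD
    -- `γ ⊖ I` and `J ⊖ γ` have zero diagonal, as have their counterparts for `κ`. A factor `I`
    -- therefore leaves only the first term of `Y`, here `n * c₁ * w`; in `gangster` the trace of
    -- `J ⊖ I` kills that one too.
    ; inner                = λ j → trans
        (trace-⊗-Y I (E j) I-I I-γ J-γ (trans (trace-E I j) (I-refl j)) refl refl)
        (trans (solve 7 (λ w c d e n x y → w :* (c :* (n :* 𝟙) :+ d :* (con (+ 0) :* x) :+ e :* (con (+ 0) :* y)) := n :* c :* w)
          refl w c₁ c₂ c₃ ν _ _) νc₁w≈1)
    ; outer                = λ j → trans
        (trace-⊗-Y (E j) I (trans (trace-E I j) (I-refl j)) refl refl I-I I-κ J-κ)
        (trans (solve 7 (λ w c d e n x y → w :* (c :* (𝟙 :* n) :+ d :* (x :* con (+ 0)) :+ e :* (y :* con (+ 0))) := n :* c :* w)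
          refl w c₁ c₂ c₃ ν _ _) νc₁w≈1)
    ; gangster             = trans (trace-⊕ˡ (I {n} ⊗ (J {n} ⊖ I)) ((J {n} ⊖ I) ⊗ I {n}) Y) (trans
        (+-cong (trace-⊗-Y I (J ⊖ I) I-I I-γ J-γ off-diagonal-I refl refl)
                (trace-⊗-Y (J ⊖ I) I off-diagonal-I refl refl I-I I-κ J-κ))
        (solve 9 (λ w c d e n x y u v →
          w :* (c :* (n :* con (+ 0)) :+ d :* (con (+ 0) :* x) :+ e :* (con (+ 0) :* y)) :+
          w :* (c :* (con (+ 0) :* n) :+ d :* (u :* con (+ 0)) :+ e :* (v :* con (+ 0))) := con (+ 0))
          refl w c₁ c₂ c₃ ν _ _ _ _))
    -- The row sums give `w * n²` times `c₁ + c₂ (b-1)² + c₃ (n-b)²`, and with `n = k b` this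
    -- bracket equals `n * c₁`.
    ; total                = trans
        (trace-⊗-Y J J (J-trace sum-I-row) (J-trace (minus-row γ-row sum-I-row)) (J-trace (minus-row (λ _ → sum-1 n) γ-row))
                       (J-trace sum-I-row) (J-trace (minus-row κ-row sum-I-row)) (J-trace (minus-row (λ _ → sum-1 n) κ-row)))
        (trans (*-congˡ (+-congˡ (*-congˡ (*-cong (*-congˡ (+-congʳ ν≈kb)) (*-congˡ (+-congʳ ν≈kb))))))
        (trans (solve 4 (λ w n b k →
          w :* (b :* (b :- 𝟙) :* (k :- 𝟙) :* (n :* 𝟙 :* (n :* 𝟙)) :+ b :* (k :- 𝟙) :* (n :* (b :- 𝟙) :* (n :* (b :- 𝟙)))
            :+ (b :- 𝟙) :* (n :* (k :* b :- b) :* (n :* (k :* b :- b)))) :=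
          k :* b :* (b :* (b :- 𝟙) :* (k :- 𝟙)) :* w :* (n :* n)) refl w ν b̂ k̂)
        (trans (*-congʳ (trans (*-congʳ (*-congʳ (sym ν≈kb))) νc₁w≈1)) (trans (*-identityˡ _) (sym (fromℕ-* n n))))))
    }

-- Cut metrics and their tours.

module Cut (ℝ : CompleteOrderedField) where
  open CompleteOrderedField ℝ hiding (zero)
  open OrderedField ℝ
  open FiniteSum ℝ
  open SDP₂ ℝ

  indicator : Bool → Carrier
  indicator a = if a then 1# else 0#

  indicator-nonNeg : ∀ a → 0# ≤ indicator a
  indicator-nonNeg true  = 0≤1
  indicator-nonNeg false = ≤-refl

  indicator-not : ∀ a → indicator (not a) ≈ 1# - indicator a
  indicator-not true  = sym (-‿inverseʳ 1#)
  indicator-not false = solve 0 (con (+ 1) := con (+ 1) :- con (+ 0)) refl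

  -- The polynomial form lets the cut be summed over all pairs as products of single sums.
  indicator-xor : ∀ a b → indicator (a xor b) ≈
    indicator a + indicator b - (indicator a * indicator b + indicator a * indicator b)
  indicator-xor true  b = trans (indicator-not b)
    (solve 1 (λ y → con (+ 1) :- y := con (+ 1) :+ y :- (con (+ 1) :* y :+ con (+ 1) :* y)) refl (indicator b))
  indicator-xor false b =
    solve 1 (λ y → y := con (+ 0) :+ y :- (con (+ 0) :* y :+ con (+ 0) :* y)) refl (indicator b)

  cutMetric : ∀ {N} → (Fin N → Bool) → Matrix N N
  cutMetric side x y = indicator (side x xor side y)

  cutMetric-instance : ∀ {N} (side : Fin N → Bool) → IsTSPInstance (cutMetric side)
  cutMetric-instance side = record
    { symmetric   = λ x y → reflexive (≡.cong indicator (xor-comm (side x) (side y)))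
    ; nonnegative = λ x y → indicator-nonNeg (side x xor side y)
    ; zeroDiag    = λ x → reflexive (≡.cong indicator (xor-same (side x)))
    ; triangle    = λ x y z → triangle (side x) (side y) (side z)
    }
    where
    triangle : ∀ a b c → indicator (a xor b) ≤ indicator (a xor c) + indicator (c xor b)
    triangle true  true  c     = +-nonNeg (indicator-nonNeg (true xor c)) (indicator-nonNeg (c xor true))
    triangle false false c     = +-nonNeg (indicator-nonNeg (false xor c)) (indicator-nonNeg (c xor false))
    triangle true  false true  = ≤-by ≤-refl (+-comm _ _)
    triangle true  false false = ≤-by ≤-refl refl
    triangle false true  true  = ≤-by ≤-refl refl
    triangle false true  false = ≤-by ≤-refl (+-comm _ _)

  module _ {n : ℕ} (side : Fin (suc n) → Bool) where

    tourCost-natural : ∀ σ → ∃ λ c → tourCost (cutMetric side) σ ≈ fromℕ c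
    tourCost-natural σ = sum-indicator (suc n) (λ i → side (σ ⟨$⟩ʳ i) xor side (σ ⟨$⟩ʳ next i))
      where
      sum-indicator : ∀ n (a : Fin n → Bool) → ∃ λ c → sum (λ i → indicator (a i)) ≈ fromℕ c
      sum-indicator zero    a = 0 , refl
      sum-indicator (suc n) a with sum-indicator n (a ∘ suc) | a zero
      ... | c , eq | true  = suc c , +-congˡ eq
      ... | c , eq | false = c , trans (+-identityˡ _) eq

    -- Without a crossing the side would be constant along a tour that visits both `x` and `y`.
    crossing-edge : ∀ {x y} → side x ≡ false → side y ≡ true → ∀ σ →
                    ∃ λ i → (side (σ ⟨$⟩ʳ i) xor side (σ ⟨$⟩ʳ next i)) ≡ true
    crossing-edge {x} {y} side-x side-y σ with Fin.any? (λ i → (side (σ ⟨$⟩ʳ i) xor side (σ ⟨$⟩ʳ next i)) ≟ᵇ true)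
    ... | yes found = found
    ... | no none   = ⊥-elim (true≢false (≡.trans (≡.sym side-y) (≡.trans (same y) (≡.trans (≡.sym (same x)) side-x))))
      where
      true≢false : ¬ (true ≡ false)
      true≢false ()
      s : Fin (suc n) → Bool
      s i = side (σ ⟨$⟩ʳ i)
      xor-false : ∀ a b → ¬ ((a xor b) ≡ true) → b ≡ a
      xor-false true  true  _ = ≡.refl
      xor-false true  false p = ⊥-elim (p ≡.refl)
      xor-false false true  p = ⊥-elim (p ≡.refl)
      xor-false false false _ = ≡.refl
      next-inject₁ : ∀ (i : Fin n) → next (inject₁ i) ≡ suc i
      next-inject₁ i = Fin.toℕ-injective (≡.trans (toℕ-next (inject₁ i)) (≡.trans
        (≡.cong (λ t → suc t % suc n) (Fin.toℕ-inject₁ i)) (ℕ.m<n⇒m%n≡m (s≤s (Fin.toℕ<n i)))))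
      -- The recursion is on the value `t`, because `inject₁ i` is not a subterm of `suc i`.
      constant : ∀ t (i : Fin (suc n)) → toℕ i ≡ t → s i ≡ s zero
      constant t       zero    _  = ≡.refl
      constant (suc t) (suc i) eq = ≡.trans
        (≡.subst (λ j → s j ≡ s (inject₁ i)) (next-inject₁ i) (xor-false _ _ λ p → none (inject₁ i , p)))
        (constant t (inject₁ i) (≡.trans (Fin.toℕ-inject₁ i) (ℕ.suc-injective eq)))
      same : ∀ z → side z ≡ s zero
      same z = ≡.trans (≡.cong side (≡.sym (Perm.inverseʳ σ))) (constant _ (σ ⟨$⟩ˡ z) ≡.refl)

    1≤tourCost : ∀ {x y} → side x ≡ false → side y ≡ true → ∀ σ → 1# ≤ tourCost (cutMetric side) σ
    1≤tourCost side-x side-y σ =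
      let (i , crossing) = crossing-edge side-x side-y σ
      in ≤-respˡ-≈ (reflexive (≡.cong indicator crossing))
           (term≤sum (suc n) (λ i → indicator-nonNeg (side (σ ⟨$⟩ʳ i) xor side (σ ⟨$⟩ʳ next i))) i)

    -- Tour costs are natural numbers, so the descent to cheaper tours ends. Excluded middle decides
    -- whether a cheaper one exists, and `bound` makes the recursion structural.
    OPT-TSP-exists : ExcludedMiddle 0ℓ → ∃ (IsOPT-TSP (cutMetric side))
    OPT-TSP-exists em = let (c , eq) = tourCost-natural Perm.id in search c (Perm.id , sym eq) c ℕ.≤-refl
      where
      IsCost : ℕ → Set
      IsCost c = IsTourCost (cutMetric side) (fromℕ c)
      search : ∀ c → IsCost c → ∀ bound → c ℕ.≤ bound → ∃ (IsOPT-TSP (cutMetric side))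
      search c attained bound c≤ with em {∃ λ c′ → c′ ℕ.< c × IsCost c′}
      search c attained zero z≤n | yes (c′ , () , _)
      search c attained (suc bound) c≤ | yes (c′ , c′<c , attained′) =
        search c′ attained′ bound (ℕ.≤-pred (ℕ.≤-trans c′<c c≤))
      ... | no none = fromℕ c , record
        { attained = attained
        ; lowerBound = λ (σ , x≈) → let (c′ , eq) = tourCost-natural σ in
            ≤-respʳ-≈ (sym (trans x≈ eq)) (fromℕ-mono (ℕ.≮⇒≥ λ c′<c → none (c′ , c′<c , σ , sym eq)))
        }

-- The objective at the feasible matrix.

module ObjectiveBound (ℝ : CompleteOrderedField) {k b : ℕ} .{{_ : NonZero (k ℕ.* b)}}
                      (2≤k : 2 ℕ.≤ k) (2≤b : 2 ℕ.≤ b) (K : Kernels.Kernel ℝ k b) (g₀ : Fin k)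
                      (r s : Fin (suc (k ℕ.* b))) where
  open CompleteOrderedField ℝ hiding (zero)
  open OrderedField ℝ
  open FiniteSum ℝ
  open Matrices ℝ
  open Kernels ℝ
  open CycleAdjacency ℝ
  open SDP₂ ℝ renaming (cycleAdjacency to C)
  open Kernel K
  open GroupedSolution ℝ 2≤k 2≤b K
  open Cut ℝ

  inGroup : Fin n → Bool
  inGroup v = does (g₀ ≟ᶠ group v)

  -- With `s` outside the chosen group, its distance to `v` is the membership indicator of `v`, so
  -- `c̄` is supported on one group.
  side : Fin (suc n) → Bool
  side = insertAt inGroup s false

  side-s : side s ≡ false
  side-s = insertAt-lookup inGroup s false

  side-punchIn : ∀ v → side (punchIn s v) ≡ inGroup v
  side-punchIn = insertAt-punchIn inGroup s false

  D : Matrix (suc n) (suc n)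
  D = cutMetric side

  private
    α β : Fin n → Fin (suc n)
    α = punchIn r
    β = punchIn s

    z : Vector Carrier n
    z v = indicator (inGroup v)

    sum-z : sum z ≈ b̂
    sum-z = trans (sum-group (I g₀)) (trans (*-congˡ (sum-I-row g₀)) (*-identityʳ b̂))

    Dβ Cα : Matrix n n
    Dβ = submatrix D β β
    Cα = submatrix C α α

    Dβ≈ : ∀ u v → Dβ u v ≈ indicator (inGroup u xor inGroup v)
    Dβ≈ u v = reflexive (≡.cong₂ (λ a b → indicator (a xor b)) (side-punchIn u) (side-punchIn v))

    Dβ-same-group : ∀ {u v} → group u ≡ group v → Dβ u v ≈ 0#
    Dβ-same-group {u} {v} eq = trans (Dβ≈ u v) (reflexive (≡.trans
      (≡.cong (λ g → indicator (inGroup u xor does (g₀ ≟ᶠ g))) (≡.sym eq)) (≡.cong indicator (xor-same (inGroup u)))))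

    -- The cut never separates vertices of one group, so of the three terms of `Y` only the one with
    -- `J ⊖ γ` meets `Dβ`.
    trace-Dβ-γ : trace (Dβ · γ) ≈ 0#
    trace-Dβ-γ = trans (sum₂-cong n n vanish) (trans (sum-cong n λ _ → sum-0 n) (sum-0 n))
      where
      vanish : ∀ u v → Dβ u v * γ v u ≈ 0#
      vanish u v with group v ≟ᶠ group u
      ... | yes eq = trans (*-congʳ (Dβ-same-group (≡.sym eq))) (zeroˡ _)
      ... | no _   = zeroʳ _

    trace-Dβ-I : trace (Dβ · I) ≈ 0#
    trace-Dβ-I = trans (trace-comm Dβ I) (trans (trace-I Dβ)
      (trans (sum-cong n λ u → Dβ-same-group {u} ≡.refl) (sum-0 n)))

    trace-Dβ-γ-I : trace (Dβ · (γ ⊖ I)) ≈ 0#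
    trace-Dβ-γ-I = trans (trace-⊖ʳ γ I Dβ) (trans (+-cong trace-Dβ-γ (-‿cong trace-Dβ-I)) (-‿inverseʳ 0#))

    trace-Dβ-J-γ : trace (Dβ · (J ⊖ γ)) ≈ ν * b̂ + ν * b̂ - (b̂ * b̂ + b̂ * b̂)
    trace-Dβ-J-γ = begin
      trace (Dβ · (J ⊖ γ))
        ≈⟨ trans (trace-⊖ʳ J γ Dβ) (trans (+-congˡ (-‿cong trace-Dβ-γ)) (solve 1 (λ x → x :- con (+ 0) := x) refl _)) ⟩
      sum (λ u → sum λ v → Dβ u v * 1#)
        ≈⟨ (sum₂-cong n n λ u v → trans (*-identityʳ _) (trans (Dβ≈ u v) (indicator-xor (inGroup u) (inGroup v)))) ⟩
      sum (λ u → sum λ v → z u + z v - (z u * z v + z u * z v))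
        ≈⟨ trans (sum₂-- n n _ _) (+-cong (sum₂-+ n n _ _) (-‿cong (sum₂-+ n n _ _))) ⟩
      sum (λ u → sum {n} λ _ → z u) + sum {n} (λ _ → sum z) - (sum (λ u → sum λ v → z u * z v) + sum (λ u → sum λ v → z u * z v))
        ≈⟨ +-cong (+-cong
             (trans (sum-cong n λ u → sum-const n (z u)) (trans (sum-*ˡ n ν z) (*-congˡ sum-z)))
             (trans (sum-const n (sum z)) (*-congˡ sum-z)))
           (-‿cong (+-cong (trans (sum-*-sum n n z z) (*-cong sum-z sum-z)) (trans (sum-*-sum n n z z) (*-cong sum-z sum-z)))) ⟩
      ν * b̂ + ν * b̂ - (b̂ * b̂ + b̂ * b̂) ∎
      where open import Relation.Binary.Reasoning.Setoid setoid

    ½-half : ½ + ½ ≈ 1#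
    ½-half = trans (solve 1 (λ t → con (+ 1) :* t :+ con (+ 1) :* t := (con (+ 1) :+ con (+ 1)) :* t) refl _)
      (⁻¹-inverseʳ _ (1≤⇒≉0 (≤-by 0≤1 refl)))

    0≤½ : 0# ≤ ½
    0≤½ = 0≤x+x⇒0≤x (≤-respʳ-≈ (sym ½-half) 0≤1)

    S : Carrier
    S = trace (Cα · (J ⊖ κ))

    8# : Carrier
    8# = 4# + 4#

    -- Each of the `n` positions has at most two neighbours, and each neighbour contributes at most
    -- `4/n`.
    S≤8 : S ≤ 8#
    S≤8 = *-cancelˡ-≤ (fromℕ-nonNeg n) ν≉0 $ begin
      ν * S                                                       ≈⟨ sum₂-*ˡ n n ν _ ⟨
      sum (λ i → sum λ j → ν * (Cα i j * (1# - κ j i)))           ≤⟨ sum₂-≤ n n adjacent ⟩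
      sum (λ i → sum λ j → Cα i j * 4#)                           ≈⟨ (sum-cong n λ i → sum-*ʳ n 4# (Cα i)) ⟩
      sum (λ i → sum (Cα i) * 4#)                                 ≤⟨ (sum-≤ n λ i → *-monoˡ-≤ 0≤4 (C-punchIn-row r (α i))) ⟩
      sum {n} (λ _ → (1# + 1#) * 4#)                              ≈⟨ sum-const n _ ⟩
      ν * ((1# + 1#) * 4#)                                        ≈⟨ *-congˡ (solve 1 (λ x → (con (+ 1) :+ con (+ 1)) :* x := x :+ x) refl 4#) ⟩
      ν * 8#                                                      ∎
      where
      open ≤-Reasoning
      0≤4 : 0# ≤ 4#
      0≤4 = +-nonNeg (+-nonNeg (+-nonNeg 0≤1 0≤1) 0≤1) 0≤1
      ν≉0 : ¬ (ν ≈ 0#)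
      ν≉0 = 1≤⇒≉0 (1≤fromℕ (ℕ.>-nonZero⁻¹ n))
      adjacent : ∀ i j → ν * (Cα i j * (1# - κ j i)) ≤ Cα i j * 4#
      adjacent i j = ≤-respˡ-≈
        (trans (solve 3 (λ c n x → c :* (n :* (con (+ 1) :- x)) := n :* (c :* (con (+ 1) :- x))) refl (Cα i j) ν (κ i j))
          (*-congˡ (*-congˡ (+-congˡ (-‿cong (κ-sym i j))))))
        (κ-adjacent K r i j)

    kbwc₁≈1 : k̂ * b̂ * c₁ * w ≈ 1#
    kbwc₁≈1 = trans (*-congʳ (*-congʳ (sym (fromℕ-* k b)))) νc₁w≈1

    -- The weight `1/(n(n-b))` meets the total cut `2b(n-b)`; the factor `½` absorbs the 2, and
    -- `b/n` is `1/k`.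
    edge-part : k̂ * trace ((Dβ ⊗ (½ *ₛ Cα)) · Y) ≈ S
    edge-part = begin
      k̂ * trace ((Dβ ⊗ (½ *ₛ Cα)) · Y)
        ≈⟨ *-congˡ (trace-⊗-Y Dβ (½ *ₛ Cα) trace-Dβ-I trace-Dβ-γ-I trace-Dβ-J-γ refl refl (trace-*ₛˡ ½ Cα (J ⊖ κ))) ⟩
      k̂ * (w * (c₁ * (0# * _) + b̂ * (k̂ - 1#) * (0# * _) + (b̂ - 1#) * ((ν * b̂ + ν * b̂ - (b̂ * b̂ + b̂ * b̂)) * (½ * S))))
        ≈⟨ *-congˡ (*-congˡ (+-cong (+-cong (trans (*-congˡ (zeroˡ _)) (zeroʳ _)) (trans (*-congˡ (zeroˡ _)) (zeroʳ _)))
             (*-congˡ (*-congʳ (+-congʳ (+-cong (*-congʳ (fromℕ-* k b)) (*-congʳ (fromℕ-* k b)))))))) ⟩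
      k̂ * (w * (0# + 0# + (b̂ - 1#) * ((k̂ * b̂ * b̂ + k̂ * b̂ * b̂ - (b̂ * b̂ + b̂ * b̂)) * (½ * S))))
        ≈⟨ solve 5 (λ k b w h s →
             k :* (w :* (con (+ 0) :+ con (+ 0) :+ (b :- con (+ 1)) :* ((k :* b :* b :+ k :* b :* b :- (b :* b :+ b :* b)) :* (h :* s)))) :=
             k :* b :* (b :* (b :- con (+ 1)) :* (k :- con (+ 1))) :* w :* ((h :+ h) :* s)) refl k̂ b̂ w ½ S ⟩
      k̂ * b̂ * c₁ * w * ((½ + ½) * S)
        ≈⟨ *-cong kbwc₁≈1 (*-congʳ ½-half) ⟩
      1# * (1# * S)
        ≈⟨ trans (*-identityˡ _) (*-identityˡ _) ⟩
      S ∎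
      where open import Relation.Binary.Reasoning.Setoid setoid

    Y-diag : ∀ p → Y p p ≈ w * c₁
    Y-diag p = *-congˡ $ begin
      c₁ * (I {n} u u * I {n} i i) + b̂ * (k̂ - 1#) * ((γ u u - I u u) * (κ i i - I i i)) + (b̂ - 1#) * ((1# - γ u u) * (1# - κ i i))
        ≈⟨ +-cong (+-cong (*-congˡ (*-cong (I-refl u) (I-refl i)))
             (*-congˡ (*-cong (+-cong (γ-diag u) (-‿cong (I-refl u))) (+-cong (κ-diag i) (-‿cong (I-refl i))))))
             (*-congˡ (*-cong (+-congˡ (-‿cong (γ-diag u))) (+-congˡ (-‿cong (κ-diag i))))) ⟩
      c₁ * (1# * 1#) + b̂ * (k̂ - 1#) * ((1# - 1#) * (1# - 1#)) + (b̂ - 1#) * ((1# - 1#) * (1# - 1#))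
        ≈⟨ solve 3 (λ c d e → c :* (con (+ 1) :* con (+ 1)) :+ d :* ((con (+ 1) :- con (+ 1)) :* (con (+ 1) :- con (+ 1)))
             :+ e :* ((con (+ 1) :- con (+ 1)) :* (con (+ 1) :- con (+ 1))) := c) refl c₁ (b̂ * (k̂ - 1#)) (b̂ - 1#) ⟩
      c₁ ∎
      where
      open import Relation.Binary.Reasoning.Setoid setoid
      u = proj₁ (remQuot {n} n p)
      i = proj₂ (remQuot {n} n p)

    R : Carrier
    R = sum λ i → C r (α i)

    D-s : ∀ v → D s (β v) ≈ z v
    D-s v = reflexive (≡.cong₂ (λ a b → indicator (a xor b)) side-s (side-punchIn v))

    -- The diagonal of `Y` is constantly `1/n`, and `c̄` sums to `b` times the number `R` of
    -- positions adjacent to `r`.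
    vertex-part : k̂ * trace (Diag (c̄ r s D) · Y) ≈ R
    vertex-part = begin
      k̂ * trace (Diag (c̄ r s D) · Y)
        ≈⟨ *-congˡ (trans (trace-Diag (c̄ r s D) Y) (trans (sum-cong (n ℕ.* n) λ p → *-congˡ (Y-diag p))
             (sum-*ʳ (n ℕ.* n) (w * c₁) (c̄ r s D)))) ⟩
      k̂ * (sum (c̄ r s D) * (w * c₁))
        -- The matrix product in `c̄` has inner dimension one; its sum unfolds with a trailing
        -- `+ 0#`.
        ≈⟨ *-congˡ (*-congʳ (sum-remQuot n n λ v i → C (α i) r * D s (β v) + 0#)) ⟩
      k̂ * (sum (λ v → sum λ i → C (α i) r * D s (β v) + 0#) * (w * c₁))
        ≈⟨ *-congˡ (*-congʳ (sum₂-cong n n λ v i → trans (+-identityʳ _) (trans (*-cong (C-sym (α i) r) (D-s v)) (*-comm _ _)))) ⟩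
      k̂ * (sum (λ v → sum λ i → z v * C r (α i)) * (w * c₁))
        ≈⟨ *-congˡ (*-congʳ (trans (sum-*-sum n n z (λ i → C r (α i))) (*-congʳ sum-z))) ⟩
      k̂ * (b̂ * R * (w * c₁))
        ≈⟨ solve 5 (λ k b R w c → k :* (b :* R :* (w :* c)) := k :* b :* c :* w :* R) refl k̂ b̂ R w c₁ ⟩
      k̂ * b̂ * c₁ * w * R
        ≈⟨ trans (*-congʳ kbwc₁≈1) (*-identityˡ R) ⟩
      R ∎
      where open import Relation.Binary.Reasoning.Setoid setoid

  10# : Carrier
  10# = 4# + 4# + (1# + 1#)

  objective-bound : k̂ * objective r s D Y ≤ 10#
  objective-bound = begin
    k̂ * objective r s D Y
      ≈⟨ *-congˡ (trace-⊕ˡ (Dβ ⊗ (½ *ₛ Cα)) (Diag (c̄ r s D)) Y) ⟩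
    k̂ * (trace ((Dβ ⊗ (½ *ₛ Cα)) · Y) + trace (Diag (c̄ r s D) · Y))
      ≈⟨ trans (distribˡ k̂ _ _) (+-cong edge-part vertex-part) ⟩
    S + R
      ≤⟨ +-mono-≤ S≤8 (C-punchIn-row r r) ⟩
    10# ∎
    where open ≤-Reasoning

  objective-nonNeg : ∀ {Z} → Feasible {n} Z → 0# ≤ objective r s D Z
  objective-nonNeg F = trace-nonNeg {A = Dβ ⊗ (½ *ₛ Cα) ⊕ Diag (c̄ r s D)}
    (λ p q → +-nonNeg
      (⊗-nonNeg {A = Dβ} {½ *ₛ Cα} (λ u v → indicator-nonNeg (side (β u) xor side (β v)))
        (λ i j → *-nonNeg 0≤½ (C-nonNeg (α i) (α j))) p q)
      (Diag-nonNeg p q)) (Feasible.nonnegative F)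
    where
    c̄-nonNeg : ∀ p → 0# ≤ c̄ r s D p
    c̄-nonNeg p = +-nonNeg (*-nonNeg (C-nonNeg (α (proj₂ (remQuot {n} n p))) r)
      (indicator-nonNeg (side s xor side (β (proj₁ (remQuot {n} n p)))))) ≤-refl
    Diag-nonNeg : ∀ p q → 0# ≤ Diag (c̄ r s D) p q
    Diag-nonNeg p q with p ≟ᶠ q
    ... | yes _ = c̄-nonNeg p
    ... | no _  = ≤-refl

-- The gap of the cut instance and the supremum.

module Gap (em : ExcludedMiddle 0ℓ) (ℝ : CompleteOrderedField) (r s : ∀ n → Fin (suc n))
           {k b : ℕ} .{{_ : NonZero (k ℕ.* b)}} (2≤k : 2 ℕ.≤ k) (2≤b : 2 ℕ.≤ b)
           (K : Kernels.Kernel ℝ k b) (g₀ : Fin k) (h₀ : Fin b) where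
  open CompleteOrderedField ℝ hiding (zero)
  open OrderedField ℝ
  open SDP₂ ℝ
  open Cut ℝ
  open Attainment em ℝ
  open GroupedSolution ℝ 2≤k 2≤b K using (n; group; Y; Y-feasible)
  open ObjectiveBound ℝ 2≤k 2≤b K g₀ (r (k ℕ.* b)) (s (k ℕ.* b))

  private
    v₀ : Fin n
    v₀ = combine g₀ h₀

    side-v₀ : side (punchIn (s n) v₀) ≡ true
    side-v₀ = ≡.trans (side-punchIn v₀) (dec-true (g₀ ≟ᶠ group v₀) (≡.sym (≡.cong proj₁ (Fin.remQuot-combine g₀ h₀))))

    minimal-tour : ∃ (IsOPT-TSP D)
    minimal-tour = OPT-TSP-exists side em

    value : Carrier
    value = objective (r n) (s n) D Y

    Y-value : IsSDP₂Value (r n) (s n) D value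
    Y-value = Y , Y-feasible , refl

    value-nonNeg : ∀ {x} → IsSDP₂Value (r n) (s n) D x → 0# ≤ x
    value-nonNeg (Z , F , x≈) = ≤-respʳ-≈ (sym x≈) (objective-nonNeg {Z} F)

    minimal-value : ∃ (IsOPT-SDP₂ (r n) (s n) D)
    minimal-value = SDP₂-minimum-exists (r n) (s n) D {x = value} Y-value value-nonNeg

  tsp sdp : Carrier
  tsp = proj₁ minimal-tour
  sdp = proj₁ minimal-value

  1≤tsp : 1# ≤ tsp
  1≤tsp = let (σ , tsp≈) = IsMinimum.attained (proj₂ minimal-tour) in
    ≤-respʳ-≈ (sym tsp≈) (1≤tourCost side side-s side-v₀ σ)

  0≤sdp : 0# ≤ sdp
  0≤sdp = value-nonNeg (IsMinimum.attained (proj₂ minimal-value))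

  k*sdp≤10 : fromℕ k * sdp ≤ 10#
  k*sdp≤10 = ≤-trans
    (*-monoʳ-≤ (fromℕ-nonNeg k) (IsMinimum.lowerBound (proj₂ minimal-value) {x = value} Y-value))
    objective-bound

  gap-ratio : ∀ {q} → Ratio tsp sdp q → IsGapRatio r s q
  gap-ratio ratio = record
    { n = n
    ; 3≤N = s≤s (ℕ.≤-trans 2≤k (ℕ.m≤m*n k b {{ℕ.>-nonZero (ℕ.≤-trans (s≤s z≤n) 2≤b)}}))
    ; D = D
    ; instanceD = cutMetric-instance side
    ; tsp = tsp
    ; sdp = sdp
    ; isTSP = proj₂ minimal-tour
    ; isSDP₂ = proj₂ minimal-value
    ; tsp≉0 = 1≤⇒≉0 1≤tsp
    ; isRatio = ratio
    }

  -- If `sdp` is zero the ratio is `⊤⁺`, which no finite `x` bounds. Otherwise `k ≤ k * tsp`, and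
  -- this is `k * sdp` times the ratio, with `k * sdp` at most `10#`.
  k≤10x : ∀ {x} → UpperBound _≤⁺_ (IsGapRatio r s) [ x ] → fromℕ k ≤ 10# * x
  k≤10x {x} bound = decide em
    where
    open ≤-Reasoning
    ⊤⁺≰ : ¬ (⊤⁺ ≤⁺ [ x ])
    ⊤⁺≰ ()
    decide : Dec (sdp ≈ 0#) → fromℕ k ≤ 10# * x
    decide (yes sdp≈0) = ⊥-elim $ ⊤⁺≰ $ bound $ gap-ratio $
      infinite (≤-trans 0≤1 1≤tsp , λ 0≈tsp → 1≤⇒≉0 1≤tsp (sym 0≈tsp)) sdp≈0
    decide (no sdp≉0) = begin
      fromℕ k                           ≈⟨ *-identityʳ _ ⟨
      fromℕ k * 1#                      ≤⟨ *-monoʳ-≤ (fromℕ-nonNeg k) 1≤tsp ⟩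
      fromℕ k * tsp                     ≈⟨ *-congˡ (trans (sym (*-identityʳ tsp)) (*-congˡ (sym (⁻¹-inverseʳ sdp sdp≉0)))) ⟩
      fromℕ k * (tsp * (sdp * sdp ⁻¹))  ≈⟨ solve 4 (λ k t v w → k :* (t :* (v :* w)) := k :* v :* (t :* w)) refl (fromℕ k) tsp sdp (sdp ⁻¹) ⟩
      fromℕ k * sdp * (tsp / sdp)       ≤⟨ *-mono-≤ 0≤10 0≤ratio k*sdp≤10 ratio≤x ⟩
      10# * x                           ∎
      where
      ratio≤x : tsp / sdp ≤ x
      ratio≤x = AddSupremum.[≤]-injective _≤_ (bound (gap-ratio (finite sdp≉0)))
      0≤10 : 0# ≤ 10#
      0≤10 = ≤-trans (*-nonNeg (fromℕ-nonNeg k) 0≤sdp) k*sdp≤10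
      0≤ratio : 0# ≤ tsp / sdp
      0≤ratio = *-nonNeg (≤-trans 0≤1 1≤tsp) (⁻¹-nonNeg 0≤sdp sdp≉0)

corollary4p2 : ExcludedMiddle 0ℓ → (ℝ : CompleteOrderedField) → (r s : ∀ n → Fin (suc n)) →
    IsSupremum (CompleteOrderedField._≤⁺_ ℝ) (SDP₂.IsGapRatio ℝ r s) ⊤⁺
corollary4p2 em ℝ r s = record { upper = λ _ → _ AddSupremum.≤⊤⁺ ; least = least }
  where
  open CompleteOrderedField ℝ using (_≤⁺_)
  open OrderedField ℝ
  least : ∀ {u} → UpperBound _≤⁺_ (SDP₂.IsGapRatio ℝ r s) u → ⊤⁺ ≤⁺ u
  least {⊤⁺}    _     = _ AddSupremum.≤⊤⁺
  least {[ x ]} bound = ⊥-elim $ archimedean _ λ n →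
    -- Taking `k = 2 + n` gives `k` and `b` at least two, as the inverse `w` requires, and still
    -- `n ≤ k`; a finite bound `x` would thus bound all naturals by `10# * x`.
    ≤-trans (fromℕ-mono (ℕ.m≤n+m n 2)) $
    Gap.k≤10x em ℝ r s {2 ℕ.+ n} {2 ℕ.+ n ℕ.+ (2 ℕ.+ n)} (s≤s (s≤s z≤n)) (s≤s (s≤s z≤n))
      (Tent.kernel ℝ (suc n) (s≤s z≤n)) zero zero bound
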